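{- Let $e,u,v,q$ be complex parameters (generic, so no denominator vanishes). Let $K_3(n):=K(q^2,q^{ -n},q^{1-n},q^{2-n},e,u,v,q^3)$ and put \[ C_r:=\frac{(e,q^3u,q^3v,q^5/u,q^5/v;q^3)_r}{(q^5/e,u,v,q^2/u,q^2/v;q^3)_r\,e^r},\qquad D_r:=\frac{(e/q^2,qu,qv,q^3/u,q^3/v;q^3)_r}{(q^3/e,u/q^2,v/q^2,1/u,1/v;q^3)_r\,e^r}. \] (i) The sequences with $\alpha_0=\beta_0=1$ and, for $r\ge0$ (resp. $r\ge1$ for $\alpha_{3r-1}$), \[ \alpha_{3r}=(-1)^rq^{\frac{9r^2-7r}{2}}C_r,\quad \alpha_{3r+1}=(-1)^{r+1}q^{\frac{9r^2+5r}{2}+2}C_r+(-1)^rq^{\frac{9r^2-r}{2}-3}D_{r+1},\quad \alpha_{3r-1}=(-1)^rq^{\frac{9r^2-7r}{2}}D_r, \] \[ \beta_n=K_3(n)\frac{(q^4/e;q^3)_n}{(q^2;q)_{2n}(q^3/e;q)_n}, \] form a Bailey pair relative to $a=q$. (ii) The sequences with $\alpha_0=\beta_0=1$ and \[ \alpha_{3r}=(-1)^rq^{\frac{9r^2-r}{2}}C_r,\quad \alpha_{3r+1}=(-1)^{r+1}q^{\frac{9r^2-r}{2}}C_r+(-1)^rq^{\frac{9r^2+5r}{2}-2}D_{r+1},\quad \alpha_{3r-1}=(-1)^rq^{\frac{9r^2-13r}{2}}D_r, \] \[ \beta_n=K_3(n)\frac{(q^4/e;q^3)_n\,q^n}{(q^2;q)_{2n}(q^3/e;q)_n},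 \] form a Bailey pair relative to $a=q$. (iii) The sequences with $\alpha_0=\beta_0=1$ and \[ \alpha_{3r}=(-1)^r\frac{1-q^{6r+2}}{1-q^2}q^{\frac{9r^2-7r}{2}}C_r,\quad \alpha_{3r+1}=(-1)^r\frac{1-q^{6r+4}}{1-q^2}q^{\frac{9r^2-r}{2}-3}D_{r+1},\quad \alpha_{3r-1}=0, \] \[ \beta_n=K_3(n)\frac{(q^4/e;q^3)_n}{(q^2;q)_{2n}(q^3/e;q)_n}, \] form a Bailey pair relative to $a=q^2$.
   Context: Notation: $(x;q)_n=\prod_{k=0}^{n-1}(1-xq^k)$ and $(x_1,\dots,x_k;q)_n=(x_1;q)_n\cdots(x_k;q)_n$. A pair of sequences $(\alpha_n)_{n\ge0},(\beta_n)_{n\ge0}$ is a Bailey pair relative to $a$ if $\alpha_0=1$ and $\beta_n=\sum_{j=0}^{n}\frac{\alpha_j}{(q;q)_{n-j}(aq;q)_{n+j}}$ for all $n\ge0$. The function $K$: for complex $a,b,c,d,e,u,v$ and a base $p$, let $\sigma_1,\dots,\sigma_4$ be the elementary symmetric functions of $b,c,d,e$ and \[ K(a,b,c,d,e,u,v,p):=\frac{uv(\sigma_3-a\sigma_1)(p\sigma_3-a\sigma_1)a^2+(1-p)uv(a^2-\sigma_4)(a^2-\sigma_2a+\sigma_4)a+(u+v)(a+uv)(\sigma_3-a\sigma_1)(a^2-p\sigma_4)a+(u^2+a)(v^2+a)(a^2-\sigma_4)(a^2-p\sigma_4)}{(a^2-bcde)(a^2-bcde\,p)(1-u)(a-u)(1-v)(a-v)}.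 \] -}

module Defs where

open import Level using (Level; _⊔_) renaming (suc to lsuc)
open import Algebra.Bundles using (CommutativeRing)
open import Relation.Nullary using (¬_)
open import Data.Product using (_×_)
open import Data.Nat as ℕ using (ℕ; zero; suc)
import Data.Nat.DivMod as ℕD
open import Data.Integer as ℤ using (ℤ; +_; -[1+_])
import Data.Integer.DivMod as ℤD

-- A field (stdlib has no Field bundle): a commutative ring with a total
-- inverse function that is a genuine inverse on nonzero elements, 1 ≠ 0.
-- (x ⁻¹ for x ≈ 0 is an arbitrary junk value; all statements below assume
-- the relevant denominators are nonzero.)

record Field (c ℓ : Level) : Set (lsuc (c ⊔ ℓ)) where
  field
    commutativeRing : CommutativeRing c ℓ
  open CommutativeRing commutativeRing public
  field
    _⁻¹        : Carrier → Carrier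
    ⁻¹-inverse : ∀ x → ¬ (x ≈ 0#) → (x * (x ⁻¹)) ≈ 1#
    1≉0        : ¬ (1# ≈ 0#)

module FieldDefs {c ℓ : Level} (F : Field c ℓ) where
  open Field F hiding (zero)

  fromℕ : ℕ → Carrier
  fromℕ zero    = 0#
  fromℕ (suc n) = 1# + fromℕ n

  CharZero : Set ℓ
  CharZero = ∀ n → ¬ (fromℕ (suc n) ≈ 0#)

  _≉0 : Carrier → Set ℓ
  x ≉0 = ¬ (x ≈ 0#)

  infixl 7 _/_
  _/_ : Carrier → Carrier → Carrier
  x / y = x * (y ⁻¹)

  pow : Carrier → ℕ → Carrier
  pow x zero    = 1#
  pow x (suc n) = x * pow x n

  powℤ : Carrier → ℤ → Carrier
  powℤ x (+ n)     = pow x n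
  powℤ x -[1+ n ]  = (pow x (suc n)) ⁻¹

  sgn : ℕ → Carrier
  sgn r = pow (- 1#) r

  poch : Carrier → Carrier → ℕ → Carrier
  poch x p zero    = 1#
  poch x p (suc n) = poch x p n * (1# - x * pow p n)

  sumTo : (ℕ → Carrier) → ℕ → Carrier
  sumTo f zero    = f zero
  sumTo f (suc n) = sumTo f n + f (suc n)

  BaileyPair : (a q : Carrier) → (ℕ → Carrier) → (ℕ → Carrier) → Set ℓ
  BaileyPair a q α β =
    (α 0 ≈ 1#) ×
    (∀ n → β n ≈ sumTo (λ j → α j / (poch q q (n ℕ.∸ j) * poch (a * q) q (n ℕ.+ j))) n)

  K : (a b c d e u v p : Carrier) → Carrier
  K a b c d e u v p = num / den
    where
    σ₁ σ₂ σ₃ σ₄ a² : Carrier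
    σ₁ = b + c + d + e
    σ₂ = b * c + b * d + b * e + c * d + c * e + d * e
    σ₃ = b * c * d + b * c * e + b * d * e + c * d * e
    σ₄ = b * c * d * e
    a² = a * a
    num = u * v * (σ₃ - a * σ₁) * (p * σ₃ - a * σ₁) * a²
        + (1# - p) * u * v * (a² - σ₄) * (a² - σ₂ * a + σ₄) * a
        + (u + v) * (a + u * v) * (σ₃ - a * σ₁) * (a² - p * σ₄) * a
        + (u * u + a) * (v * v + a) * (a² - σ₄) * (a² - p * σ₄)
    den = (a² - b * c * d * e) * (a² - b * c * d * e * p)
        * (1# - u) * (a - u) * (1# - v) * (a - v)

  Kden : (a b c d e u v p : Carrier) → Carrier
  Kden a b c d e u v p =
    (a * a - b * c * d * e) * (a * a - b * c * d * e * p)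
    * (1# - u) * (a - u) * (1# - v) * (a - v)

  qm : Carrier → ℤ → ℕ → Carrier
  qm q k n = powℤ q (k ℤ.- (+ n))

  K₃ : (e u v q : Carrier) → ℕ → Carrier
  K₃ e u v q n = K (pow q 2) (qm q (+ 0) n) (qm q (+ 1) n) (qm q (+ 2) n) e u v (pow q 3)

  K₃den : (e u v q : Carrier) → ℕ → Carrier
  K₃den e u v q n = Kden (pow q 2) (qm q (+ 0) n) (qm q (+ 1) n) (qm q (+ 2) n) e u v (pow q 3)

  Cnum Cden Dnum Dden : (e u v q : Carrier) → ℕ → Carrier
  Cnum e u v q r = let Q = pow q 3 in
    poch e Q r * poch (Q * u) Q r * poch (Q * v) Q r
      * poch (pow q 5 / u) Q r * poch (pow q 5 / v) Q r
  Cden e u v q r = let Q = pow q 3 in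
    poch (pow q 5 / e) Q r * poch u Q r * poch v Q r
      * poch (pow q 2 / u) Q r * poch (pow q 2 / v) Q r
  Dnum e u v q r = let Q = pow q 3 in
    poch (e / pow q 2) Q r * poch (q * u) Q r * poch (q * v) Q r
      * poch (Q / u) Q r * poch (Q / v) Q r
  Dden e u v q r = let Q = pow q 3 in
    poch (Q / e) Q r * poch (u / pow q 2) Q r * poch (v / pow q 2) Q r
      * poch (1# / u) Q r * poch (1# / v) Q r

  C D : (e u v q : Carrier) → ℕ → Carrier
  C e u v q r = Cnum e u v q r / (Cden e u v q r * pow e r)
  D e u v q r = Dnum e u v q r / (Dden e u v q r * pow e r)

  -- exponent (9r^2 + s r)/2 + t  (9r^2 + s r is always even for odd s)
  ex : ℤ → ℤ → ℕ → ℤ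
  ex s t r = ((+ 9) ℤ.* (+ r) ℤ.* (+ r) ℤ.+ s ℤ.* (+ r)) ℤD./ (+ 2) ℤ.+ t

  -- a sequence given by α_0 = 1, α_{3r} = f₀ r (r ≥ 1), α_{3r+1} = f₁ r,
  -- α_{3r-1} = f₋ r (r ≥ 1)
  seq3 : (f₀ f₁ f₋ : ℕ → Carrier) → ℕ → Carrier
  seq3 f₀ f₁ f₋ zero = 1#
  seq3 f₀ f₁ f₋ (suc n) with suc n ℕD.% 3
  ... | 0 = f₀ (suc n ℕD./ 3)
  ... | 1 = f₁ (suc n ℕD./ 3)
  ... | _ = f₋ (suc (suc n ℕD./ 3))

  seqβ : (ℕ → Carrier) → ℕ → Carrier
  seqβ g zero    = 1#
  seqβ g (suc n) = g (suc n)

  βfac : (e q : Carrier) → ℕ → Carrier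
  βfac e q n = poch (pow q 4 / e) (pow q 3) n
             / (poch (pow q 2) q (2 ℕ.* n) * poch (pow q 3 / e) q n)

  α-i β-i α-ii β-ii α-iii β-iii : (e u v q : Carrier) → ℕ → Carrier
  α-i e u v q = seq3
    (λ r → sgn r * powℤ q (ex (ℤ.- (+ 7)) (+ 0) r) * C e u v q r)
    (λ r → sgn (suc r) * powℤ q (ex (+ 5) (+ 2) r) * C e u v q r
           + sgn r * powℤ q (ex (ℤ.- (+ 1)) (ℤ.- (+ 3)) r) * D e u v q (suc r))
    (λ r → sgn r * powℤ q (ex (ℤ.- (+ 7)) (+ 0) r) * D e u v q r)
  β-i e u v q = seqβ (λ n → K₃ e u v q n * βfac e q n)

  α-ii e u v q = seq3
    (λ r → sgn r * powℤ q (ex (ℤ.- (+ 1)) (+ 0) r) * C e u v q r)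
    (λ r → sgn (suc r) * powℤ q (ex (ℤ.- (+ 1)) (+ 0) r) * C e u v q r
           + sgn r * powℤ q (ex (+ 5) (ℤ.- (+ 2)) r) * D e u v q (suc r))
    (λ r → sgn r * powℤ q (ex (ℤ.- (+ 13)) (+ 0) r) * D e u v q r)
  β-ii e u v q = seqβ (λ n → K₃ e u v q n * βfac e q n * pow q n)

  α-iii e u v q = seq3
    (λ r → sgn r * ((1# - pow q (6 ℕ.* r ℕ.+ 2)) / (1# - pow q 2))
           * powℤ q (ex (ℤ.- (+ 7)) (+ 0) r) * C e u v q r)
    (λ r → sgn r * ((1# - pow q (6 ℕ.* r ℕ.+ 4)) / (1# - pow q 2))
           * powℤ q (ex (ℤ.- (+ 1)) (ℤ.- (+ 3)) r) * D e u v q (suc r))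
    (λ r → 0#)
  β-iii e u v q = seqβ (λ n → K₃ e u v q n * βfac e q n)

  record Generic (e u v q : Carrier) : Set ℓ where
    field
      q≉0     : q ≉0
      e≉0     : e ≉0
      u≉0     : u ≉0
      v≉0     : v ≉0
      1-q²≉0  : (1# - pow q 2) ≉0
      Cden≉0  : ∀ r → Cden e u v q r ≉0
      Dden≉0  : ∀ r → Dden e u v q r ≉0
      K₃den≉0 : ∀ n → K₃den e u v q n ≉0
      βden≉0  : ∀ n → (poch (pow q 2) q (2 ℕ.* n) * poch (pow q 3 / e) q n) ≉0
      -- (q;q)_m, (aq;q)_m for a = q and a = q^2
      qq≉0    : ∀ m → poch q q m ≉0
      q²q≉0   : ∀ m → poch (q * q) q m ≉0
      q³q≉0   : ∀ m → poch (pow q 2 * q) q m ≉0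

{-# OPTIONS --safe #-}

-- Relative to q², the indices j = 3r and j = 3r + 1 (the latter read as r ↦ −r − 1) form the two
-- halves of one bilateral very-well-poised series in base p = q³, with a = q² and parameters
-- b, c, d = q⁻ⁿ, q¹⁻ⁿ, q²⁻ⁿ and e. Writing T = q^j and Y = 1 + a T², the parameters u and v only
-- multiply its terms by (u Y − (u² + a) T)(v Y − (v² + a) T), so (iii) is a statement about the
-- moments M₀, M₁, M₂ of the series without u and v, taken against T², T Y and Y². Two telescoping
-- sums express M₁ and M₂ by M₀, which produces the numerator of K. Passing from n to n + 1
-- replaces d by d / p, and combined with the formula for M₁ this gives a first-order recurrence
-- that evaluates M₀. Finally (i) and (ii) follow from (iii) by summation by parts.

module Submission where

open import Defs
open import Algebra.Bundles using (CommutativeRing)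
import Algebra.Properties.CommutativeSemigroup as CommutativeSemigroupProperties
import Algebra.Properties.Ring as RingProperties
import Algebra.Properties.Semiring.Mult as SemiringMult
open import Data.Bool using (Bool; true; T; _∧_)
open import Data.Fin using (Fin; zero; suc)
open import Data.Integer as ℤ using (+_; -[1+_]; _⊖_)
import Data.Integer.DivMod as ℤD
import Data.Integer.Properties as ℤP
open import Data.List using (List; []; _∷_)
open import Data.Nat as ℕ using (ℕ; zero; suc; _≤_; _<_; z≤n; s≤s)
import Data.Nat.DivMod as ℕD
open import Data.Nat.Divisibility using (divides-refl)
import Data.Nat.Properties as ℕP
open import Data.Product using (_×_; _,_; proj₁; proj₂)
open import Data.Vec using (Vec; []; _∷_; lookup; tabulate)
open import Data.Vec.N-ary using (N-ary; _$ⁿ_)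
open import Function using (_∘_)
open import Level using (Level)
open import Relation.Binary.PropositionalEquality as ≡ using (_≡_)
import Relation.Binary.Reasoning.Setoid as SetoidReasoning

-- The reflection x ↦ 1/(a x), which exchanges q^(-3r-3) and q^(3r+1), shapes the construction. Up
-- to powers of x it exchanges `Π⁺` and `Π⁻`: it takes a² Π⁺ / x² to Π⁻ / x². The difference of
-- these two is therefore antisymmetric, hence (1 - a x²) / x times a polynomial in Y / x. This is
-- why combinations of the three moments telescope and where their coefficients come from. Against
-- T² the series is Bailey's very-well-poised 6ψ6 with argument p a² / (b c d e), so a product
-- formula for M₀ is to be expected. The closed form is reached by a recurrence in n rather than by
-- that summation, because the new parameter q^(-n-1) is itself one of b, c, d and makes the
-- eliminated coefficient factor. The obstacle of cutting a bilateral series at the origin is that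
-- each half keeps a lower boundary term. Neither vanishes alone; they cancel because of the
-- relative size of the two initial terms. Quotients are avoided throughout: each relation is
-- multiplied out and then obtained as a ring identity modulo a few hypotheses.

-- A reflective solver for commutative ring identities.

infixl 6 _:+_ _:-_
infixl 7 _:*_
infixr 8 _:^_
infix  9 :-_
infix  4 _:=_

data Expr (n : ℕ) : Set where
  var       : Fin n → Expr n
  :0 :1     : Expr n
  _:+_ _:*_ : Expr n → Expr n → Expr n
  :-_       : Expr n → Expr n

_:-_ : ∀ {n} → Expr n → Expr n → Expr n
x :- y = x :+ (:- y)

_:^_ : ∀ {n} → Expr n → ℕ → Expr n
x :^ zero  = :1
x :^ suc k = x :* x :^ k

_:=_ : ∀ {n} → Expr n → Expr n → Expr n × Expr n
_:=_ = _,_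

-- Dense recursive polynomials; the coefficient (k , l) stands for k − l.
Poly : ℕ → Set
Poly zero    = ℕ × ℕ
Poly (suc n) = List (Poly n)

const : ∀ n → ℕ × ℕ → Poly n
const zero    k = k
const (suc n) k = const n k ∷ []

varᴾ : ∀ {n} → Fin n → Poly n
varᴾ {suc n} zero    = const n (0 , 0) ∷ const n (1 , 0) ∷ []
varᴾ {suc n} (suc i) = varᴾ i ∷ []

mutual
  addᴾ : ∀ n → Poly n → Poly n → Poly n
  addᴾ zero    (a , b) (c , d) = (a ℕ.+ c) , (b ℕ.+ d)
  addᴾ (suc n) f g = addᴸ n f g

  addᴸ : ∀ n → List (Poly n) → List (Poly n) → List (Poly n)
  addᴸ n []      g       = g
  addᴸ n (x ∷ f) []      = x ∷ f
  addᴸ n (x ∷ f) (y ∷ g) = addᴾ n x y ∷ addᴸ n f g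

mutual
  negᴾ : ∀ n → Poly n → Poly n
  negᴾ zero    (a , b) = b , a
  negᴾ (suc n) f       = negᴸ n f

  negᴸ : ∀ n → List (Poly n) → List (Poly n)
  negᴸ n []      = []
  negᴸ n (x ∷ f) = negᴾ n x ∷ negᴸ n f

mutual
  mulᴾ : ∀ n → Poly n → Poly n → Poly n
  mulᴾ zero    (a , b) (c , d) = (a ℕ.* c ℕ.+ b ℕ.* d) , (a ℕ.* d ℕ.+ b ℕ.* c)
  mulᴾ (suc n) f g = mulᴸ n f g

  scaleᴸ : ∀ n → Poly n → List (Poly n) → List (Poly n)
  scaleᴸ n x []      = []
  scaleᴸ n x (y ∷ g) = mulᴾ n x y ∷ scaleᴸ n x g

  mulᴸ : ∀ n → List (Poly n) → List (Poly n) → List (Poly n)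
  mulᴸ n []      g = []
  mulᴸ n (x ∷ f) g = addᴸ n (scaleᴸ n x g) (const n (0 , 0) ∷ mulᴸ n f g)

mutual
  isZeroᴾ : ∀ n → Poly n → Bool
  isZeroᴾ zero    (a , b) = a ℕ.≡ᵇ b
  isZeroᴾ (suc n) f       = isZeroᴸ n f

  isZeroᴸ : ∀ n → List (Poly n) → Bool
  isZeroᴸ n []      = true
  isZeroᴸ n (x ∷ f) = isZeroᴾ n x ∧ isZeroᴸ n f

normalise : ∀ {n} → Expr n → Poly n
normalise {n} (var i)  = varᴾ i
normalise {n} :0       = const n (0 , 0)
normalise {n} :1       = const n (1 , 0)
normalise {n} (x :+ y) = addᴾ n (normalise x) (normalise y)
normalise {n} (x :* y) = mulᴾ n (normalise x) (normalise y)
normalise {n} (:- x)   = negᴾ n (normalise x)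

variables : ∀ n → Vec (Expr n) n
variables n = tabulate var

module RingSolver {c ℓ : Level} (R : CommutativeRing c ℓ) where
  open CommutativeRing R hiding (zero)
  open RingProperties ring
  open SemiringMult semiring using (×1-homo-*; ×-homo-+) renaming (_×_ to _·_)
  open CommutativeSemigroupProperties +-commutativeSemigroup using (interchange)
  open CommutativeSemigroupProperties *-commutativeSemigroup using (x∙yz≈y∙xz)
  open SetoidReasoning setoid

  ⟦_⟧ : ∀ {n} → Expr n → Vec Carrier n → Carrier
  ⟦ var i  ⟧ ρ = lookup ρ i
  ⟦ :0     ⟧ ρ = 0#
  ⟦ :1     ⟧ ρ = 1#
  ⟦ x :+ y ⟧ ρ = ⟦ x ⟧ ρ + ⟦ y ⟧ ρ
  ⟦ x :* y ⟧ ρ = ⟦ x ⟧ ρ * ⟦ y ⟧ ρ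
  ⟦ :- x   ⟧ ρ = - ⟦ x ⟧ ρ

  mutual
    evalᴾ : ∀ n → Poly n → Vec Carrier n → Carrier
    evalᴾ zero    (a , b) ρ       = a · 1# - b · 1#
    evalᴾ (suc n) f       (x ∷ ρ) = evalᴸ n f x ρ

    evalᴸ : ∀ n → List (Poly n) → Carrier → Vec Carrier n → Carrier
    evalᴸ n []      x ρ = 0#
    evalᴸ n (k ∷ f) x ρ = evalᴾ n k ρ + x * evalᴸ n f x ρ

  ≈0+x*0 : ∀ {x y} → y ≈ y + x * 0#
  ≈0+x*0 {x} {y} = sym (trans (+-congˡ (zeroʳ x)) (+-identityʳ y))

  const-correct : ∀ n k ρ → evalᴾ n (const n k) ρ ≈ proj₁ k · 1# - proj₂ k · 1#
  const-correct zero    k ρ       = refl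
  const-correct (suc n) k (x ∷ ρ) = trans (sym ≈0+x*0) (const-correct n k ρ)

  const0-correct : ∀ n ρ → evalᴾ n (const n (0 , 0)) ρ ≈ 0#
  const0-correct n ρ = trans (const-correct n (0 , 0) ρ) (-‿inverseʳ 0#)

  const1-correct : ∀ n ρ → evalᴾ n (const n (1 , 0)) ρ ≈ 1#
  const1-correct n ρ = begin
    evalᴾ n (const n (1 , 0)) ρ ≈⟨ const-correct n (1 , 0) ρ ⟩
    (1# + 0#) - 0#              ≈⟨ +-cong (+-identityʳ 1#) -0#≈0# ⟩
    1# + 0#                     ≈⟨ +-identityʳ 1# ⟩
    1#                          ∎

  var-correct : ∀ {n} (i : Fin n) ρ → evalᴾ n (varᴾ i) ρ ≈ lookup ρ i
  var-correct {suc n} zero (x ∷ ρ) = begin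
    evalᴾ n (const n (0 , 0)) ρ + x * (evalᴾ n (const n (1 , 0)) ρ + x * 0#)
      ≈⟨ +-cong (const0-correct n ρ) (*-congˡ (trans (sym ≈0+x*0) (const1-correct n ρ))) ⟩
    0# + x * 1# ≈⟨ +-identityˡ _ ⟩
    x * 1#      ≈⟨ *-identityʳ x ⟩
    x           ∎
  var-correct {suc n} (suc i) (x ∷ ρ) = trans (sym ≈0+x*0) (var-correct i ρ)

  difference-+ : ∀ a b c d → (a - b) + (c - d) ≈ (a + c) - (b + d)
  difference-+ a b c d = trans (interchange a (- b) c (- d)) (+-congˡ (-‿+-comm b d))

  difference-* : ∀ a b c d → (a - b) * (c - d) ≈ (a * c + b * d) - (a * d + b * c)
  difference-* a b c d = begin
    (a - b) * (c - d)                             ≈⟨ distribʳ _ a (- b) ⟩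
    a * (c - d) + - b * (c - d)                   ≈⟨ +-cong (distribˡ a c (- d)) (sym (-‿distribˡ-* b _)) ⟩
    (a * c + a * - d) + - (b * (c - d))           ≈⟨ +-cong (+-congˡ (sym (-‿distribʳ-* a d))) (-‿cong (distribˡ b c (- d))) ⟩
    (a * c - a * d) + - (b * c + b * - d)         ≈⟨ +-congˡ (sym (-‿+-comm (b * c) (b * - d))) ⟩
    (a * c - a * d) + (- (b * c) - b * - d)       ≈⟨ +-congˡ (+-comm _ _) ⟩
    (a * c - a * d) + (- (b * - d) - b * c)       ≈⟨ +-congˡ (+-congʳ (trans (-‿cong (sym (-‿distribʳ-* b d))) (-‿involutive _))) ⟩
    (a * c - a * d) + (b * d - b * c)             ≈⟨ difference-+ (a * c) (a * d) (b * d) (b * c) ⟩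
    (a * c + b * d) - (a * d + b * c)             ∎

  mutual
    add-correct : ∀ n f g ρ → evalᴾ n (addᴾ n f g) ρ ≈ evalᴾ n f ρ + evalᴾ n g ρ
    add-correct zero (a , b) (c , d) ρ = begin
      (a ℕ.+ c) · 1# - (b ℕ.+ d) · 1#
        ≈⟨ +-cong (×-homo-+ 1# a c) (-‿cong (×-homo-+ 1# b d)) ⟩
      (a · 1# + c · 1#) - (b · 1# + d · 1#)
        ≈⟨ difference-+ _ _ _ _ ⟨
      (a · 1# - b · 1#) + (c · 1# - d · 1#) ∎
    add-correct (suc n) f g (x ∷ ρ) = addᴸ-correct n f g x ρ

    addᴸ-correct : ∀ n f g x ρ → evalᴸ n (addᴸ n f g) x ρ ≈ evalᴸ n f x ρ + evalᴸ n g x ρ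
    addᴸ-correct n []      g       x ρ = sym (+-identityˡ _)
    addᴸ-correct n (k ∷ f) []      x ρ = sym (+-identityʳ _)
    addᴸ-correct n (k ∷ f) (l ∷ g) x ρ = begin
      evalᴾ n (addᴾ n k l) ρ + x * evalᴸ n (addᴸ n f g) x ρ
        ≈⟨ +-cong (add-correct n k l ρ) (trans (*-congˡ (addᴸ-correct n f g x ρ)) (distribˡ x _ _)) ⟩
      (evalᴾ n k ρ + evalᴾ n l ρ) + (x * evalᴸ n f x ρ + x * evalᴸ n g x ρ)
        ≈⟨ interchange _ _ _ _ ⟩
      (evalᴾ n k ρ + x * evalᴸ n f x ρ) + (evalᴾ n l ρ + x * evalᴸ n g x ρ) ∎

  mutual
    neg-correct : ∀ n f ρ → evalᴾ n (negᴾ n f) ρ ≈ - evalᴾ n f ρ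
    neg-correct zero (a , b) ρ = begin
      b · 1# - a · 1#           ≈⟨ +-comm _ _ ⟩
      - (a · 1#) + b · 1#       ≈⟨ +-congˡ (-‿involutive _) ⟨
      - (a · 1#) - - (b · 1#)   ≈⟨ -‿+-comm _ _ ⟩
      - (a · 1# - b · 1#)       ∎
    neg-correct (suc n) f (x ∷ ρ) = negᴸ-correct n f x ρ

    negᴸ-correct : ∀ n f x ρ → evalᴸ n (negᴸ n f) x ρ ≈ - evalᴸ n f x ρ
    negᴸ-correct n []      x ρ = sym -0#≈0#
    negᴸ-correct n (k ∷ f) x ρ = trans
      (+-cong (neg-correct n k ρ) (trans (*-congˡ (negᴸ-correct n f x ρ)) (sym (-‿distribʳ-* x _))))
      (-‿+-comm _ _)

  mutual
    mul-correct : ∀ n f g ρ → evalᴾ n (mulᴾ n f g) ρ ≈ evalᴾ n f ρ * evalᴾ n g ρ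
    mul-correct zero (a , b) (c , d) ρ = begin
      (a ℕ.* c ℕ.+ b ℕ.* d) · 1# - (a ℕ.* d ℕ.+ b ℕ.* c) · 1#
        ≈⟨ +-cong (×1-homo-+* a c b d) (-‿cong (×1-homo-+* a d b c)) ⟩
      (a · 1# * c · 1# + b · 1# * d · 1#) - (a · 1# * d · 1# + b · 1# * c · 1#)
        ≈⟨ difference-* _ _ _ _ ⟨
      (a · 1# - b · 1#) * (c · 1# - d · 1#) ∎
      where
      ×1-homo-+* : ∀ i j k l → (i ℕ.* j ℕ.+ k ℕ.* l) · 1# ≈ i · 1# * j · 1# + k · 1# * l · 1#
      ×1-homo-+* i j k l = trans (×-homo-+ 1# (i ℕ.* j) (k ℕ.* l)) (+-cong (×1-homo-* i j) (×1-homo-* k l))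
    mul-correct (suc n) f g (x ∷ ρ) = mulᴸ-correct n f g x ρ

    scale-correct : ∀ n k g x ρ → evalᴸ n (scaleᴸ n k g) x ρ ≈ evalᴾ n k ρ * evalᴸ n g x ρ
    scale-correct n k []      x ρ = sym (zeroʳ _)
    scale-correct n k (l ∷ g) x ρ = begin
      evalᴾ n (mulᴾ n k l) ρ + x * evalᴸ n (scaleᴸ n k g) x ρ
        ≈⟨ +-cong (mul-correct n k l ρ) (trans (*-congˡ (scale-correct n k g x ρ)) (x∙yz≈y∙xz x _ _)) ⟩
      evalᴾ n k ρ * evalᴾ n l ρ + evalᴾ n k ρ * (x * evalᴸ n g x ρ)
        ≈⟨ distribˡ _ _ _ ⟨
      evalᴾ n k ρ * (evalᴾ n l ρ + x * evalᴸ n g x ρ) ∎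

    mulᴸ-correct : ∀ n f g x ρ → evalᴸ n (mulᴸ n f g) x ρ ≈ evalᴸ n f x ρ * evalᴸ n g x ρ
    mulᴸ-correct n []      g x ρ = sym (zeroˡ _)
    mulᴸ-correct n (k ∷ f) g x ρ = begin
      evalᴸ n (addᴸ n (scaleᴸ n k g) (const n (0 , 0) ∷ mulᴸ n f g)) x ρ
        ≈⟨ addᴸ-correct n (scaleᴸ n k g) _ x ρ ⟩
      evalᴸ n (scaleᴸ n k g) x ρ + (evalᴾ n (const n (0 , 0)) ρ + x * evalᴸ n (mulᴸ n f g) x ρ)
        ≈⟨ +-cong (scale-correct n k g x ρ) (trans (+-congʳ (const0-correct n ρ)) (+-identityˡ _)) ⟩
      evalᴾ n k ρ * evalᴸ n g x ρ + x * evalᴸ n (mulᴸ n f g) x ρ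
        ≈⟨ +-congˡ (trans (*-congˡ (mulᴸ-correct n f g x ρ)) (sym (*-assoc x _ _))) ⟩
      evalᴾ n k ρ * evalᴸ n g x ρ + x * evalᴸ n f x ρ * evalᴸ n g x ρ
        ≈⟨ distribʳ _ _ _ ⟨
      (evalᴾ n k ρ + x * evalᴸ n f x ρ) * evalᴸ n g x ρ ∎

  mutual
    isZero-sound : ∀ n f ρ → T (isZeroᴾ n f) → evalᴾ n f ρ ≈ 0#
    isZero-sound zero (a , b) ρ a≡b
      with ≡.refl ← ℕP.≡ᵇ⇒≡ a b a≡b = -‿inverseʳ _
    isZero-sound (suc n) f (x ∷ ρ) z = isZeroᴸ-sound n f x ρ z

    isZeroᴸ-sound : ∀ n f x ρ → T (isZeroᴸ n f) → evalᴸ n f x ρ ≈ 0#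
    isZeroᴸ-sound n []      x ρ z = refl
    isZeroᴸ-sound n (k ∷ f) x ρ z with isZeroᴾ n k in eq
    ... | true = begin
      evalᴾ n k ρ + x * evalᴸ n f x ρ
        ≈⟨ +-cong (isZero-sound n k ρ (≡.subst T (≡.sym eq) _)) (*-congˡ (isZeroᴸ-sound n f x ρ z)) ⟩
      0# + x * 0# ≈⟨ ≈0+x*0 ⟨
      0#          ∎

  normalise-correct : ∀ {n} (e : Expr n) ρ → evalᴾ n (normalise e) ρ ≈ ⟦ e ⟧ ρ
  normalise-correct (var i)  ρ = var-correct i ρ
  normalise-correct {n} :0   ρ = const0-correct n ρ
  normalise-correct {n} :1   ρ = const1-correct n ρ
  normalise-correct (x :+ y) ρ = trans (add-correct _ (normalise x) (normalise y) ρ)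
    (+-cong (normalise-correct x ρ) (normalise-correct y ρ))
  normalise-correct (x :* y) ρ = trans (mul-correct _ (normalise x) (normalise y) ρ)
    (*-cong (normalise-correct x ρ) (normalise-correct y ρ))
  normalise-correct (:- x)   ρ = trans (neg-correct _ (normalise x) ρ) (-‿cong (normalise-correct x ρ))

  -- Only the difference of the two sides is tested for zero, so polynomials need no canonical form:
  -- trailing zeros and unreduced pairs are harmless. For a concrete identity the hidden argument
  -- computes to the unit type and is filled in by itself.
  solve : ∀ {n} (ρ : Vec Carrier n) (eqn : N-ary n (Expr n) (Expr n × Expr n)) →
          let l , r = eqn $ⁿ variables n in
          {T (isZeroᴾ n (normalise (l :- r)))} → ⟦ l ⟧ ρ ≈ ⟦ r ⟧ ρ
  solve {n} ρ eqn {z} = let l , r = eqn $ⁿ variables n in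
    x∙y⁻¹≈ε⇒x≈y _ _ (trans (sym (normalise-correct (l :- r) ρ)) (isZero-sound n (normalise (l :- r)) ρ z))

-- Field arithmetic, powers, shifted factorials and finite sums.

module FieldProperties {c ℓ : Level} (F : Field c ℓ) where
  open Field F hiding (zero)
  open FieldDefs F
  open RingSolver commutativeRing using (solve)
  open RingProperties ring using (x∙y⁻¹≈ε⇒x≈y)
  open SetoidReasoning setoid

  ≈⇒-≈0 : ∀ {x y} → x ≈ y → x - y ≈ 0#
  ≈⇒-≈0 {x} {y} x≈y = trans (+-congʳ x≈y) (-‿inverseʳ y)

  -- Ring solving modulo hypotheses: L − R is exhibited as a combination of their differences.
  lincomb₁ : ∀ {L R k l r} → l ≈ r → L - R ≈ k * (l - r) → L ≈ R
  lincomb₁ {k = k} h eq =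
    x∙y⁻¹≈ε⇒x≈y _ _ (trans eq (trans (*-congˡ (≈⇒-≈0 h)) (zeroʳ k)))

  lincomb₂ : ∀ {L R k l r k′ l′ r′} → l ≈ r → l′ ≈ r′ →
             L - R ≈ k * (l - r) + k′ * (l′ - r′) → L ≈ R
  lincomb₂ {L} {R} {k} {l} {r} {k′} {l′} {r′} h h′ eq = x∙y⁻¹≈ε⇒x≈y _ _ (begin
    L - R                          ≈⟨ eq ⟩
    k * (l - r) + k′ * (l′ - r′)   ≈⟨ +-cong (*-congˡ (≈⇒-≈0 h)) (*-congˡ (≈⇒-≈0 h′)) ⟩
    k * 0# + k′ * 0#               ≈⟨ +-cong (zeroʳ k) (zeroʳ k′) ⟩
    0# + 0#                        ≈⟨ +-identityʳ 0# ⟩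
    0#                             ∎)

  lincomb₃ : ∀ {L R k l r k′ l′ r′ k″ l″ r″} → l ≈ r → l′ ≈ r′ → l″ ≈ r″ →
             L - R ≈ k * (l - r) + k′ * (l′ - r′) + k″ * (l″ - r″) → L ≈ R
  lincomb₃ {k″ = k″} h h′ h″ eq = lincomb₂ h h′
    (trans eq (trans (+-congˡ (trans (*-congˡ (≈⇒-≈0 h″)) (zeroʳ k″))) (+-identityʳ _)))

  ≉0-resp : ∀ {x y} → x ≈ y → x ≉0 → y ≉0
  ≉0-resp x≈y x≉0 y≈0 = x≉0 (trans x≈y y≈0)

  *-≉0ˡ : ∀ {x y} → (x * y) ≉0 → x ≉0
  *-≉0ˡ xy≉0 x≈0 = xy≉0 (trans (*-congʳ x≈0) (zeroˡ _))

  *-≉0ʳ : ∀ {x y} → (x * y) ≉0 → y ≉0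
  *-≉0ʳ xy≉0 y≈0 = xy≉0 (trans (*-congˡ y≈0) (zeroʳ _))

  *-cancelˡ-≉0 : ∀ {x y z} → x ≉0 → x * y ≈ x * z → y ≈ z
  *-cancelˡ-≉0 {x} {y} {z} x≉0 xy≈xz = lincomb₂ (*-congˡ {x = x ⁻¹} xy≈xz) (⁻¹-inverse x x≉0)
    (solve (x ∷ x ⁻¹ ∷ y ∷ z ∷ []) (λ x i y z →
      y :- z := :1 :* (i :* (x :* y) :- i :* (x :* z)) :+ (z :- y) :* (x :* i :- :1)))

  *-cancelʳ-≉0 : ∀ {x y z} → x ≉0 → y * x ≈ z * x → y ≈ z
  *-cancelʳ-≉0 x≉0 yx≈zx = *-cancelˡ-≉0 x≉0 (trans (*-comm _ _) (trans yx≈zx (*-comm _ _)))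

  *-≉0 : ∀ {x y} → x ≉0 → y ≉0 → (x * y) ≉0
  *-≉0 x≉0 y≉0 xy≈0 = y≉0 (*-cancelˡ-≉0 x≉0 (trans xy≈0 (sym (zeroʳ _))))

  /-*-cancel : ∀ {x y} → y ≉0 → x / y * y ≈ x
  /-*-cancel {x} {y} y≉0 = lincomb₁ (⁻¹-inverse y y≉0)
    (solve (x ∷ y ∷ y ⁻¹ ∷ []) (λ x y i → x :* i :* y :- x := x :* (y :* i :- :1)))

  /-unique : ∀ {x y z} → y ≉0 → x ≈ z * y → x / y ≈ z
  /-unique y≉0 x≈zy = *-cancelʳ-≉0 y≉0 (trans (/-*-cancel y≉0) x≈zy)

  ⁻¹-unique : ∀ {x y} → x ≉0 → x * y ≈ 1# → x ⁻¹ ≈ y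
  ⁻¹-unique {x} x≉0 xy≈1 = *-cancelˡ-≉0 x≉0 (trans (⁻¹-inverse x x≉0) (sym xy≈1))

  ⁻¹-≉0 : ∀ {x} → x ≉0 → (x ⁻¹) ≉0
  ⁻¹-≉0 {x} x≉0 = *-≉0ʳ {x} (≉0-resp (sym (⁻¹-inverse x x≉0)) 1≉0)

  ⁻¹-*-homo : ∀ {x y} → x ≉0 → y ≉0 → (x * y) ⁻¹ ≈ x ⁻¹ * y ⁻¹
  ⁻¹-*-homo {x} {y} x≉0 y≉0 = ⁻¹-unique (*-≉0 x≉0 y≉0)
    (lincomb₂ (⁻¹-inverse x x≉0) (⁻¹-inverse y y≉0)
      (solve (x ∷ y ∷ x ⁻¹ ∷ y ⁻¹ ∷ []) (λ x y i k →
        x :* y :* (i :* k) :- :1 := y :* k :* (x :* i :- :1) :+ :1 :* (y :* k :- :1))))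

  pow-≉0 : ∀ {x} → x ≉0 → ∀ n → pow x n ≉0
  pow-≉0 x≉0 zero    = 1≉0
  pow-≉0 x≉0 (suc n) = *-≉0 x≉0 (pow-≉0 x≉0 n)

  pow-+ : ∀ x m n → pow x (m ℕ.+ n) ≈ pow x m * pow x n
  pow-+ x zero    n = sym (*-identityˡ _)
  pow-+ x (suc m) n = trans (*-congˡ (pow-+ x m n)) (sym (*-assoc x _ _))

  pow-pow : ∀ x k n → pow (pow x k) n ≈ pow x (n ℕ.* k)
  pow-pow x k zero    = refl
  pow-pow x k (suc n) = trans (*-congˡ (pow-pow x k n)) (sym (pow-+ x k (n ℕ.* k)))

  module _ {q : Carrier} (q≉0 : q ≉0) where

    -- Multiplied out so that the recursion never has to split on the sign of m - n; the mixed-sign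
    -- cases of `powℤ-+` then follow by cancellation.
    powℤ-⊖ : ∀ m n → powℤ q (m ⊖ n) * pow q n ≈ pow q m
    powℤ-⊖ m       zero    = *-identityʳ _
    powℤ-⊖ zero    (suc n) = trans (*-comm _ _) (⁻¹-inverse _ (pow-≉0 q≉0 (suc n)))
    powℤ-⊖ (suc m) (suc n) rewrite ℤP.[1+m]⊖[1+n]≡m⊖n m n = lincomb₁ (powℤ-⊖ m n)
      (solve (powℤ q (m ⊖ n) ∷ pow q n ∷ pow q m ∷ q ∷ []) (λ i y x q →
        i :* (q :* y) :- q :* x := q :* (i :* y :- x)))

    powℤ-≉0 : ∀ i → powℤ q i ≉0
    powℤ-≉0 (+ n)    = pow-≉0 q≉0 n
    powℤ-≉0 -[1+ n ] = ⁻¹-≉0 (pow-≉0 q≉0 (suc n))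

    powℤ-+ : ∀ i j → powℤ q (i ℤ.+ j) ≈ powℤ q i * powℤ q j
    powℤ-+ (+ m)    (+ n)    = pow-+ q m n
    powℤ-+ (+ m)    -[1+ n ] = *-cancelʳ-≉0 (pow-≉0 q≉0 (suc n))
      (trans (powℤ-⊖ m (suc n)) (sym (/-*-cancel (pow-≉0 q≉0 (suc n)))))
    powℤ-+ -[1+ m ] (+ n)    = *-cancelʳ-≉0 (pow-≉0 q≉0 (suc m))
      (trans (powℤ-⊖ n (suc m)) (sym (trans (*-congʳ (*-comm _ _)) (/-*-cancel (pow-≉0 q≉0 (suc m))))))
    powℤ-+ -[1+ m ] -[1+ n ] = ⁻¹-unique (pow-≉0 q≉0 (suc (suc (m ℕ.+ n))))
      (lincomb₃ (⁻¹-inverse (pow q (suc m)) (pow-≉0 q≉0 (suc m))) (⁻¹-inverse (pow q (suc n)) (pow-≉0 q≉0 (suc n)))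
        (pow-+ q m n)
        (solve (q ∷ pow q m ∷ pow q n ∷ pow q (m ℕ.+ n) ∷ pow q (suc m) ⁻¹ ∷ pow q (suc n) ⁻¹ ∷ [])
          (λ q x y z i k → q :* (q :* z) :* (i :* k) :- :1
            := q :* y :* k :* (q :* x :* i :- :1) :+ :1 :* (q :* y :* k :- :1)
               :+ q :* q :* i :* k :* (z :- x :* y))))

  poch-cong : ∀ {x y} p → x ≈ y → ∀ n → poch x p n ≈ poch y p n
  poch-cong p x≈y zero    = refl
  poch-cong p x≈y (suc n) = *-cong (poch-cong p x≈y n) (+-congˡ (-‿cong (*-congʳ x≈y)))

  -- Both sides are (x;p)_{n+1}, with its first or its last factor split off.
  poch-shift : ∀ x p n → poch (p * x) p n * (1# - x) ≈ poch x p n * (1# - x * pow p n)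
  poch-shift x p zero    = solve (x ∷ []) (λ x → :1 :* (:1 :- x) := :1 :* (:1 :- x :* :1))
  poch-shift x p (suc n) = lincomb₁ (poch-shift x p n)
    (solve (x ∷ p ∷ pow p n ∷ poch (p * x) p n ∷ poch x p n ∷ []) (λ x p t A B →
      A :* (:1 :- p :* x :* t) :* (:1 :- x) :- B :* (:1 :- x :* t) :* (:1 :- x :* (p :* t))
        := (:1 :- p :* x :* t) :* (A :* (:1 :- x) :- B :* (:1 :- x :* t))))

  -- The factor that the parameter u (or v) contributes to C and D.
  poch-pair-shift : ∀ x y p n →
    poch (p * x) p n * poch (p * y) p n * ((1# - x) * (1# - y)) ≈
    poch x p n * poch y p n * ((1# - x * pow p n) * (1# - y * pow p n))
  poch-pair-shift x y p n = lincomb₂ (poch-shift x p n) (poch-shift y p n)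
    (solve (x ∷ y ∷ pow p n ∷ poch (p * x) p n ∷ poch (p * y) p n ∷ poch x p n ∷ poch y p n ∷ [])
      (λ x y t A B a b → A :* B :* ((:1 :- x) :* (:1 :- y)) :- a :* b :* ((:1 :- x :* t) :* (:1 :- y :* t))
        := B :* (:1 :- y) :* (A :* (:1 :- x) :- a :* (:1 :- x :* t))
           :+ a :* (:1 :- x :* t) :* (B :* (:1 :- y) :- b :* (:1 :- y :* t))))

  sumTo-cong : ∀ {f g} n → (∀ j → j ≤ n → f j ≈ g j) → sumTo f n ≈ sumTo g n
  sumTo-cong zero    h = h 0 z≤n
  sumTo-cong (suc n) h =
    +-cong (sumTo-cong n (λ j j≤n → h j (ℕP.m≤n⇒m≤1+n j≤n))) (h (suc n) ℕP.≤-refl)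

  sumTo-+ : ∀ f g n → sumTo (λ j → f j + g j) n ≈ sumTo f n + sumTo g n
  sumTo-+ f g zero    = refl
  sumTo-+ f g (suc n) = lincomb₁ (sumTo-+ f g n)
    (solve (sumTo (λ j → f j + g j) n ∷ sumTo f n ∷ sumTo g n ∷ f (suc n) ∷ g (suc n) ∷ [])
      (λ S A B a b → S :+ (a :+ b) :- (A :+ a :+ (B :+ b)) := :1 :* (S :- (A :+ B))))

  sumTo-*ˡ : ∀ k f n → sumTo (λ j → k * f j) n ≈ k * sumTo f n
  sumTo-*ˡ k f zero    = refl
  sumTo-*ˡ k f (suc n) = trans (+-congʳ (sumTo-*ˡ k f n)) (sym (distribˡ k _ _))

  sumTo-telescope : ∀ (g : ℕ → Carrier) n → sumTo (λ r → g (suc r) - g r) n ≈ g (suc n) - g 0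
  sumTo-telescope g zero    = refl
  sumTo-telescope g (suc n) = lincomb₁ (sumTo-telescope g n)
    (solve (sumTo (λ r → g (suc r) - g r) n ∷ g 0 ∷ g (suc n) ∷ g (suc (suc n)) ∷ [])
      (λ S a b c → S :+ (c :- b) :- (c :- a) := :1 :* (S :- (b :- a))))

  sumTo-extend : ∀ f n k → (∀ j → n < j → f j ≈ 0#) → sumTo f (k ℕ.+ n) ≈ sumTo f n
  sumTo-extend f n zero    h = refl
  sumTo-extend f n (suc k) h =
    trans (+-cong (sumTo-extend f n k h) (h _ (s≤s (ℕP.m≤n+m n k)))) (+-identityʳ _)

  sumTo-thirds : ∀ f n →
    sumTo f (2 ℕ.+ n ℕ.* 3) ≈ sumTo (λ r → f (r ℕ.* 3) + f (1 ℕ.+ r ℕ.* 3) + f (2 ℕ.+ r ℕ.* 3)) n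
  sumTo-thirds f zero    = refl
  sumTo-thirds f (suc n) = lincomb₁ (sumTo-thirds f n)
    (solve (sumTo f (2 ℕ.+ n ℕ.* 3) ∷ S ∷ f (3 ℕ.+ n ℕ.* 3) ∷ f (4 ℕ.+ n ℕ.* 3) ∷ f (5 ℕ.+ n ℕ.* 3) ∷ [])
      (λ S S′ x y z → S :+ x :+ y :+ z :- (S′ :+ (x :+ y :+ z)) := :1 :* (S :- S′)))
    where S = sumTo (λ r → f (r ℕ.* 3) + f (1 ℕ.+ r ℕ.* 3) + f (2 ℕ.+ r ℕ.* 3)) n

  -- Abel summation: each `δ j` occurs in `α j` and in `α (suc j)`, and the terms are regrouped by
  -- `δ j`. The second occurrence of `δ n` lies outside the range, which accounts for the boundary
  -- term.
  sumTo-by-parts : ∀ (α δ κ μ ω : ℕ → Carrier) →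
    α 0 ≈ κ 0 * δ 0 → (∀ j → α (suc j) ≈ κ (suc j) * δ (suc j) - μ j * δ j) →
    ∀ n → sumTo (λ j → α j * ω j) n ≈
          sumTo (λ j → δ j * (κ j * ω j - μ j * ω (suc j))) n + μ n * δ n * ω (suc n)
  sumTo-by-parts α δ κ μ ω α₀ α₊ zero = lincomb₁ α₀
    (solve (α 0 ∷ δ 0 ∷ κ 0 ∷ μ 0 ∷ ω 0 ∷ ω 1 ∷ []) (λ a d k m w w′ →
      a :* w :- (d :* (k :* w :- m :* w′) :+ m :* d :* w′) := w :* (a :- k :* d)))
  sumTo-by-parts α δ κ μ ω α₀ α₊ (suc n) = lincomb₂ (sumTo-by-parts α δ κ μ ω α₀ α₊ n) (α₊ n)
    (solve (sumTo (λ j → α j * ω j) n ∷ sumTo (λ j → δ j * (κ j * ω j - μ j * ω (suc j))) n ∷ α (suc n)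
      ∷ δ n ∷ δ (suc n) ∷ κ (suc n) ∷ μ n ∷ μ (suc n) ∷ ω (suc n) ∷ ω (suc (suc n)) ∷ [])
      (λ S S′ a d d′ k m m′ w w′ →
        S :+ a :* w :- (S′ :+ d′ :* (k :* w :- m′ :* w′) :+ m′ :* d′ :* w′)
        := :1 :* (S :- (S′ :+ m :* d :* w)) :+ w :* (a :- (k :* d′ :- m :* d))))

-- Telescoping sums for very-well-poised series.

module WellPoised {c ℓ : Level} (F : Field c ℓ) (a b c d e p : Field.Carrier F) where
  open Field F hiding (zero)
  open FieldDefs F
  open FieldProperties F
  open RingSolver commutativeRing using (solve)
  open SetoidReasoning setoid

  σ₁ σ₂ σ₃ σ₄ : Carrier
  σ₁ = b + c + d + e
  σ₂ = b * c + b * d + b * e + c * d + c * e + d * e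
  σ₃ = b * c * d + b * c * e + b * d * e + c * d * e
  σ₄ = b * c * d * e

  -- lin₁ and lin₂ are the combinations of the moment weights whose sums telescope.
  Y Π⁺ Π⁻ m₀ m₁ m₂ lin₁ lin₂ : Carrier → Carrier
  Y x = 1# + a * (x * x)
  Π⁺ x = (1# - b * x) * (1# - c * x) * (1# - d * x) * (1# - e * x)
  Π⁻ x = (b - a * x) * (c - a * x) * (d - a * x) * (e - a * x)
  m₀ x = (1# - a * (x * x)) * (x * x)
  m₁ x = (1# - a * (x * x)) * (x * Y x)
  m₂ x = (1# - a * (x * x)) * (Y x * Y x)
  lin₁ x = (a * a - σ₄) * m₁ x + a * (σ₃ - a * σ₁) * m₀ x
  lin₂ x = (a * a - p * σ₄) * m₂ x + a * (p * σ₃ - a * σ₁) * m₁ x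
         - (1# - p) * a * (a * a - σ₂ * a + σ₄) * m₀ x

  -- Since x ↦ 1/(a x) takes a² Π⁺ / x² to Π⁻ / x², their difference is antisymmetric, hence (1 - a
  -- x²) / x times a polynomial of degree one in Y / x. Multiplication by x³ turns this into a
  -- combination of `m₁` and `m₀`.
  lin₁-difference : ∀ x → lin₁ x ≈ x * (a * a * Π⁺ x - Π⁻ x)
  lin₁-difference x = solve (a ∷ b ∷ c ∷ d ∷ e ∷ x ∷ []) (λ a b c d e x →
    let w  = :1 :- a :* (x :* x)
        y  = :1 :+ a :* (x :* x)
        s₁ = b :+ c :+ d :+ e
        s₃ = b :* c :* d :+ b :* c :* e :+ b :* d :* e :+ c :* d :* e
        s₄ = b :* c :* d :* e
    in (a :* a :- s₄) :* (w :* (x :* y)) :+ a :* (s₃ :- a :* s₁) :* (w :* (x :* x))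
       := x :* (a :* a :* ((:1 :- b :* x) :* (:1 :- c :* x) :* (:1 :- d :* x) :* (:1 :- e :* x))
               :- (b :- a :* x) :* (c :- a :* x) :* (d :- a :* x) :* (e :- a :* x)))

  -- The same reflection exchanges (1 + a p x²) / x and (p + a x²) / x, so these factors preserve
  -- the antisymmetry and raise the degree in Y / x to two, which brings in `m₂`.
  lin₂-difference : ∀ x → lin₂ x ≈ a * a * (1# + a * p * (x * x)) * Π⁺ x - (p + a * (x * x)) * Π⁻ x
  lin₂-difference x = solve (a ∷ b ∷ c ∷ d ∷ e ∷ p ∷ x ∷ []) (λ a b c d e p x →
    let w  = :1 :- a :* (x :* x)
        y  = :1 :+ a :* (x :* x)
        s₁ = b :+ c :+ d :+ e
        s₂ = b :* c :+ b :* d :+ b :* e :+ c :* d :+ c :* e :+ d :* e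
        s₃ = b :* c :* d :+ b :* c :* e :+ b :* d :* e :+ c :* d :* e
        s₄ = b :* c :* d :* e
    in (a :* a :- p :* s₄) :* (w :* (y :* y)) :+ a :* (p :* s₃ :- a :* s₁) :* (w :* (x :* y))
         :- (:1 :- p) :* a :* (a :* a :- s₂ :* a :+ s₄) :* (w :* (x :* x))
       := a :* a :* (:1 :+ a :* p :* (x :* x)) :* ((:1 :- b :* x) :* (:1 :- c :* x) :* (:1 :- d :* x) :* (:1 :- e :* x))
            :- (p :+ a :* (x :* x)) :* ((b :- a :* x) :* (c :- a :* x) :* (d :- a :* x) :* (e :- a :* x)))

  -- The factors x and p + a x² are those from which the step to p x extracts exactly one p, leaving
  -- x and 1 + a p x². This p turns the constant k of `Half` into a², so that `G (suc r)` becomes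
  -- the `Π⁺` part of the difference above and `G r` its `Π⁻` part.
  G₁ G₂ : (x f : ℕ → Carrier) → ℕ → Carrier
  G₁ x f r = f r * (x r * Π⁻ (x r))
  G₂ x f r = f r * ((p + a * (x r * x r)) * Π⁻ (x r))

  -- f is the summand (without 1 − a x²) along one end of the bilateral series, at x = x₀ pʳ.
  record Half (k : Carrier) (x f : ℕ → Carrier) : Set ℓ where
    field
      pk≈a²  : p * k ≈ a * a
      x-step : ∀ r → x (suc r) ≈ p * x r
      f-step : ∀ r → f (suc r) * Π⁻ (x (suc r)) ≈ k * (f r * Π⁺ (x r))

    G₁-step : ∀ r → f r * lin₁ (x r) ≈ G₁ x f (suc r) - G₁ x f r
    G₁-step r = lincomb₂ (lin₁-difference (x r)) G₁-suc
      (solve (f r ∷ lin₁ (x r) ∷ x r ∷ a ∷ Π⁺ (x r) ∷ Π⁻ (x r) ∷ G₁ x f (suc r) ∷ []) (λ f l x a P M G →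
        f :* l :- (G :- f :* (x :* M))
        := f :* (l :- x :* (a :* a :* P :- M)) :+ (:- :1) :* (G :- a :* a :* (x :* (f :* P)))))
      where
      G₁-suc : G₁ x f (suc r) ≈ a * a * (x r * (f r * Π⁺ (x r)))
      G₁-suc = lincomb₃ (f-step r) (x-step r) pk≈a²
        (solve (f (suc r) ∷ x (suc r) ∷ Π⁻ (x (suc r)) ∷ f r ∷ x r ∷ Π⁺ (x r) ∷ a ∷ p ∷ k ∷ [])
          (λ f′ x′ M f x P a p k → f′ :* (x′ :* M) :- a :* a :* (x :* (f :* P))
            := x′ :* (f′ :* M :- k :* (f :* P)) :+ k :* f :* P :* (x′ :- p :* x)
               :+ x :* f :* P :* (p :* k :- a :* a)))

    G₂-step : ∀ r → f r * lin₂ (x r) ≈ G₂ x f (suc r) - G₂ x f r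
    G₂-step r = lincomb₂ (lin₂-difference (x r)) G₂-suc
      (solve (f r ∷ lin₂ (x r) ∷ x r ∷ a ∷ p ∷ Π⁺ (x r) ∷ Π⁻ (x r) ∷ G₂ x f (suc r) ∷ []) (λ f l x a p P M G →
        f :* l :- (G :- f :* ((p :+ a :* (x :* x)) :* M))
        := f :* (l :- (a :* a :* (:1 :+ a :* p :* (x :* x)) :* P :- (p :+ a :* (x :* x)) :* M))
           :+ (:- :1) :* (G :- a :* a :* ((:1 :+ a :* p :* (x :* x)) :* (f :* P)))))
      where
      G₂-suc : G₂ x f (suc r) ≈ a * a * ((1# + a * p * (x r * x r)) * (f r * Π⁺ (x r)))
      G₂-suc = lincomb₃ (f-step r) (x-step r) pk≈a²
        (solve (f (suc r) ∷ x (suc r) ∷ Π⁻ (x (suc r)) ∷ f r ∷ x r ∷ Π⁺ (x r) ∷ a ∷ p ∷ k ∷ [])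
          (λ f′ x′ M f x P a p k →
            f′ :* ((p :+ a :* (x′ :* x′)) :* M) :- a :* a :* ((:1 :+ a :* p :* (x :* x)) :* (f :* P))
            := (p :+ a :* (x′ :* x′)) :* (f′ :* M :- k :* (f :* P))
               :+ k :* f :* P :* a :* (x′ :+ p :* x) :* (x′ :- p :* x)
               :+ f :* P :* (:1 :+ a :* p :* (x :* x)) :* (p :* k :- a :* a)))

  module TwoHalves {k : Carrier} {x f x′ f′ : ℕ → Carrier}
    (half : Half k x f) (half′ : Half k x′ f′) (n : ℕ)
    (f≈0 : f (suc n) ≈ 0#) (f′≈0 : f′ (suc n) ≈ 0#) where

    -- The upper ends vanish by truncation. The lower ends are the two faces of the cut in the
    -- bilateral series, so only their sum is required to vanish.
    telescope-halves : ∀ (lin : Carrier → Carrier) (G G′ : ℕ → Carrier) →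
      (∀ r → f r * lin (x r) ≈ G (suc r) - G r) → (∀ r → f′ r * lin (x′ r) ≈ G′ (suc r) - G′ r) →
      G (suc n) ≈ 0# → G′ (suc n) ≈ 0# → G 0 + G′ 0 ≈ 0# →
      sumTo (λ r → f r * lin (x r) + f′ r * lin (x′ r)) n ≈ 0#
    telescope-halves lin G G′ step step′ Gₙ G′ₙ G₀ = begin
      sumTo (λ r → f r * lin (x r) + f′ r * lin (x′ r)) n
        ≈⟨ sumTo-cong n (λ r _ → +-cong (step r) (step′ r)) ⟩
      sumTo (λ r → (G (suc r) - G r) + (G′ (suc r) - G′ r)) n
        ≈⟨ sumTo-+ _ _ n ⟩
      sumTo (λ r → G (suc r) - G r) n + sumTo (λ r → G′ (suc r) - G′ r) n
        ≈⟨ +-cong (sumTo-telescope G n) (sumTo-telescope G′ n) ⟩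
      (G (suc n) - G 0) + (G′ (suc n) - G′ 0)
        ≈⟨ lincomb₃ Gₙ G′ₙ G₀ (solve (G 0 ∷ G′ 0 ∷ G (suc n) ∷ G′ (suc n) ∷ [])
             (λ g g′ h h′ → (h :- g) :+ (h′ :- g′) :- :0
               := :1 :* (h :- :0) :+ :1 :* (h′ :- :0) :+ (:- :1) :* (g :+ g′ :- :0))) ⟩
      0# ∎

    vanish : ∀ {y z} → y ≈ 0# → y * z ≈ 0#
    vanish y≈0 = trans (*-congʳ y≈0) (zeroˡ _)

    sum-lin₁ : G₁ x f 0 + G₁ x′ f′ 0 ≈ 0# → sumTo (λ r → f r * lin₁ (x r) + f′ r * lin₁ (x′ r)) n ≈ 0#
    sum-lin₁ = telescope-halves lin₁ (G₁ x f) (G₁ x′ f′) (Half.G₁-step half) (Half.G₁-step half′)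
      (vanish f≈0) (vanish f′≈0)

    sum-lin₂ : G₂ x f 0 + G₂ x′ f′ 0 ≈ 0# → sumTo (λ r → f r * lin₂ (x r) + f′ r * lin₂ (x′ r)) n ≈ 0#
    sum-lin₂ = telescope-halves lin₂ (G₂ x f) (G₂ x′ f′) (Half.G₂-step half) (Half.G₂-step half′)
      (vanish f≈0) (vanish f′≈0)

-- Residues modulo 3 and the integer exponents.

-- A counterpart of `seq3` by structural recursion, without division. The third component is indexed
-- as 3r + 2, whereas `seq3` reads the same position as 3(r + 1) - 1.
interleave : ∀ {ℓ} {A : Set ℓ} → (f g h : ℕ → A) → ℕ → A
interleave f g h 0 = f 0
interleave f g h 1 = g 0
interleave f g h 2 = h 0
interleave f g h (suc (suc (suc j))) = interleave (f ∘ suc) (g ∘ suc) (h ∘ suc) j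

module _ {ℓ} {A : Set ℓ} where
  interleave-0 : ∀ (f g h : ℕ → A) r → interleave f g h (r ℕ.* 3) ≡ f r
  interleave-0 f g h zero    = ≡.refl
  interleave-0 f g h (suc r) = interleave-0 (f ∘ suc) (g ∘ suc) (h ∘ suc) r

  interleave-1 : ∀ (f g h : ℕ → A) r → interleave f g h (1 ℕ.+ r ℕ.* 3) ≡ g r
  interleave-1 f g h zero    = ≡.refl
  interleave-1 f g h (suc r) = interleave-1 (f ∘ suc) (g ∘ suc) (h ∘ suc) r

  interleave-2 : ∀ (f g h : ℕ → A) r → interleave f g h (2 ℕ.+ r ℕ.* 3) ≡ h r
  interleave-2 f g h zero    = ≡.refl
  interleave-2 f g h (suc r) = interleave-2 (f ∘ suc) (g ∘ suc) (h ∘ suc) r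

-- exponent₃ r = (9r² − 7r) / 2
exponent₃ : ℕ → ℕ
exponent₃ zero    = 0
exponent₃ (suc r) = suc (exponent₃ r ℕ.+ (r ℕ.* 3 ℕ.+ (r ℕ.* 3 ℕ.+ r ℕ.* 3)))

data Third : ℕ → Set where
  0+3* : ∀ r → Third (r ℕ.* 3)
  1+3* : ∀ r → Third (1 ℕ.+ r ℕ.* 3)
  2+3* : ∀ r → Third (2 ℕ.+ r ℕ.* 3)

third : ∀ j → Third j
third 0 = 0+3* 0
third 1 = 1+3* 0
third 2 = 2+3* 0
third (suc (suc (suc j))) with third j
... | 0+3* r = 0+3* (suc r)
... | 1+3* r = 1+3* (suc r)
... | 2+3* r = 2+3* (suc r)

[i+r*3]/3≡r : ∀ i → i < 3 → ∀ r → (i ℕ.+ r ℕ.* 3) ℕD./ 3 ≡ r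
[i+r*3]/3≡r i i<3 r = ≡.trans (ℕD.+-distrib-/-∣ʳ i (divides-refl r))
  (≡.cong₂ ℕ._+_ (ℕD.m<n⇒m/n≡0 i<3) (ℕD.m*n/n≡m r 3))

[i+r*3]%3≡i : ∀ i → i < 3 → ∀ r → (i ℕ.+ r ℕ.* 3) ℕD.% 3 ≡ i
[i+r*3]%3≡i i i<3 r = ≡.trans (ℕD.[m+kn]%n≡m%n i r 3) (ℕD.m<n⇒m%n≡m i<3)

ex-double : ∀ r → + 9 ℤ.* + r ℤ.* + r ℤ.+ (ℤ.- + 7) ℤ.* + r ≡ + exponent₃ r ℤ.* + 2
ex-double zero    = ≡.refl
ex-double (suc r) = lincomb (ex-double r) (ℤP.pos-* r 3)
  where
  open RingSolver ℤP.+-*-commutativeRing using (solve)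
  open RingProperties ℤP.+-*-ring using (x∙y⁻¹≈ε⇒x≈y)
  :ℕ : ∀ {n} → ℕ → Expr n
  :ℕ zero    = :0
  :ℕ (suc k) = :1 :+ :ℕ k
  lincomb : + 9 ℤ.* + r ℤ.* + r ℤ.+ (ℤ.- + 7) ℤ.* + r ≡ + exponent₃ r ℤ.* + 2 → + (r ℕ.* 3) ≡ + r ℤ.* + 3 →
            + 9 ℤ.* + suc r ℤ.* + suc r ℤ.+ (ℤ.- + 7) ℤ.* + suc r ≡ + exponent₃ (suc r) ℤ.* + 2
  lincomb eq eq′ = ≡.trans (solve (+ r ∷ []) (λ r →
      :ℕ 9 :* (:1 :+ r) :* (:1 :+ r) :+ (:- :ℕ 7) :* (:1 :+ r)
      := :ℕ 9 :* r :* r :+ (:- :ℕ 7) :* r :+ (:1 :+ (r :* :ℕ 3 :+ (r :* :ℕ 3 :+ r :* :ℕ 3))) :* :ℕ 2))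
    (≡.trans (≡.cong₂ (λ x y → x ℤ.+ (+ 1 ℤ.+ (y ℤ.+ (y ℤ.+ y))) ℤ.* + 2) eq (≡.sym eq′))
      (solve (+ exponent₃ r ∷ + (r ℕ.* 3) ∷ []) (λ z m →
        z :* :ℕ 2 :+ (:1 :+ (m :+ (m :+ m))) :* :ℕ 2 := (:1 :+ (z :+ (m :+ (m :+ m)))) :* :ℕ 2)))

-- By division with remainder, twice the distance between i and the quotient equals the remainder,
-- which is below 2; hence the distance is 0.
i*2/2≡i : ∀ i → (i ℤ.* + 2) ℤD./ + 2 ≡ i
i*2/2≡i i = ≡.sym (ℤP.i-j≡0⇒i≡j i y (ℤP.∣i∣≡0⇒i≡0 (∣i-y∣≡0 _ ∣i-y∣*2≡ρ)))
  where
  open RingSolver ℤP.+-*-commutativeRing using (solve)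
  y = (i ℤ.* + 2) ℤD./ + 2
  ρ = (i ℤ.* + 2) ℤD.% + 2
  ∣i-y∣*2≡ρ : ℤ.∣ i ℤ.- y ∣ ℕ.* 2 ≡ ρ
  ∣i-y∣*2≡ρ = ≡.trans (≡.sym (ℤP.abs-* (i ℤ.- y) (+ 2))) (≡.cong ℤ.∣_∣ (≡.trans
    (solve (i ∷ y ∷ + 2 ∷ []) (λ i y t → (i :- y) :* t := i :* t :- y :* t))
    (≡.trans (≡.cong (ℤ._- y ℤ.* + 2) (ℤD.a≡a%n+[a/n]*n (i ℤ.* + 2) (+ 2)))
      (solve (+ ρ ∷ y ℤ.* + 2 ∷ []) (λ r x → r :+ x :- x := r)))))
  ∣i-y∣≡0 : ∀ k → k ℕ.* 2 ≡ ρ → k ≡ 0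
  ∣i-y∣≡0 zero    _  = ≡.refl
  ∣i-y∣≡0 (suc k) eq with s≤s (s≤s ()) ← ≡.subst (_< 2) (≡.sym eq) (ℤD.n%d<d (i ℤ.* + 2) (+ 2))

-- The Bailey kernel and its contiguity relations.

module CubicBaileyPairs {c ℓ : Level} (F : Field c ℓ) (e u v q : Field.Carrier F) (gen : FieldDefs.Generic F e u v q) where
  open Field F hiding (zero)
  open FieldDefs F
  open FieldProperties F
  open RingSolver commutativeRing using (solve)
  open SetoidReasoning setoid
  open Generic gen

  a Q : Carrier
  a = pow q 2
  Q = pow q 3

  a≉0 : a ≉0
  a≉0 = pow-≉0 q≉0 2

  -- 1 / (q;q)_{n-j}, with the convention that it vanishes for j > n.
  recip-qq : ℕ → ℕ → Carrier
  recip-qq n       zero    = poch q q n ⁻¹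
  recip-qq zero    (suc j) = 0#
  recip-qq (suc n) (suc j) = recip-qq n j

  recip-qq-≤ : ∀ {n j} → j ≤ n → recip-qq n j ≡ poch q q (n ℕ.∸ j) ⁻¹
  recip-qq-≤ z≤n       = ≡.refl
  recip-qq-≤ (s≤s j≤n) = recip-qq-≤ j≤n

  recip-qq-> : ∀ {n j} → n < j → recip-qq n j ≡ 0#
  recip-qq-> {zero}  (s≤s n<j) = ≡.refl
  recip-qq-> {suc n} (s≤s n<j) = recip-qq-> n<j

  recip-poch-step : ∀ x → (∀ m → poch x q m ≉0) → ∀ m →
    poch x q m ⁻¹ ≈ poch x q (suc m) ⁻¹ * (1# - x * pow q m)
  recip-poch-step x x≉0 m = ⁻¹-unique (x≉0 m)
    (trans (solve (poch x q m ∷ poch x q (suc m) ⁻¹ ∷ 1# - x * pow q m ∷ [])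
             (λ P i y → P :* (i :* y) := P :* y :* i))
           (⁻¹-inverse _ (x≉0 (suc m))))

  -- The factor 1 - q^(n-j) of (q;q)_{n-j}, multiplied by q^j to avoid negative powers. With the
  -- zero convention no bound on j is needed: at j = n the difference of powers vanishes, and beyond
  -- n both sides do.
  recip-qq-step : ∀ n j → recip-qq n j * (pow q j - pow q n) ≈ pow q j * recip-qq n (suc j)
  recip-qq-step zero zero = solve (poch q q 0 ⁻¹ ∷ []) (λ x → x :* (:1 :- :1) := :1 :* :0)
  recip-qq-step (suc n) zero = lincomb₁ (recip-poch-step q qq≉0 n)
    (solve (poch q q n ⁻¹ ∷ poch q q (suc n) ⁻¹ ∷ q ∷ pow q n ∷ []) (λ i i′ q x →
      i′ :* (:1 :- q :* x) :- :1 :* i := (:- :1) :* (i :- i′ :* (:1 :- q :* x))))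
  recip-qq-step zero (suc j) = trans (zeroˡ _) (sym (zeroʳ _))
  recip-qq-step (suc n) (suc j) = lincomb₁ (recip-qq-step n j)
    (solve (q ∷ pow q j ∷ pow q n ∷ recip-qq n j ∷ recip-qq n (suc j) ∷ []) (λ q t x i i′ →
      i :* (q :* t :- q :* x) :- q :* t :* i′ := q :* (i :* (t :- x) :- t :* i′)))

  weight : Carrier → ℕ → ℕ → Carrier
  weight x n j = recip-qq n j * poch (x * q) q (n ℕ.+ j) ⁻¹

  weight-> : ∀ x {n j} → n < j → weight x n j ≈ 0#
  weight-> x n<j rewrite recip-qq-> n<j = zeroˡ _

  bailey-sum : ∀ x → (∀ m → poch (x * q) q m ≉0) → ∀ (α : ℕ → Carrier) n →
    sumTo (λ j → α j / (poch q q (n ℕ.∸ j) * poch (x * q) q (n ℕ.+ j))) n ≈ sumTo (λ j → α j * weight x n j) n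
  bailey-sum x xq≉0 α n = sumTo-cong n term
    where
    term : ∀ j → j ≤ n → α j / (poch q q (n ℕ.∸ j) * poch (x * q) q (n ℕ.+ j)) ≈ α j * weight x n j
    term j j≤n rewrite recip-qq-≤ j≤n = *-congˡ (⁻¹-*-homo (qq≉0 (n ℕ.∸ j)) (xq≉0 (n ℕ.+ j)))

  -- Extends the second factorial to index n + j + 1, which is the index found in both
  -- `weight a n (suc j)` and `weight a (suc n) j`, so that the kernels can be compared over one
  -- reciprocal.
  weight-a-unfold : ∀ n j → weight a n j ≈
    recip-qq n j * (poch (a * q) q (suc (n ℕ.+ j)) ⁻¹ * (1# - Q * pow q n * pow q j))
  weight-a-unfold n j = *-congˡ (trans (recip-poch-step (a * q) q³q≉0 (n ℕ.+ j))
    (lincomb₁ (pow-+ q n j)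
      (solve (poch (a * q) q (suc (n ℕ.+ j)) ⁻¹ ∷ q ∷ pow q n ∷ pow q j ∷ pow q (n ℕ.+ j) ∷ []) (λ i q x t y →
        i :* (:1 :- q :^ 2 :* q :* y) :- i :* (:1 :- q :^ 3 :* x :* t)
        := (:- (i :* q :^ 3)) :* (y :- x :* t)))))

  b c′ d : ℕ → Carrier
  b = qm q (+ 0)
  c′ = qm q (+ 1)
  d = qm q (+ 2)

  qm-* : ∀ k n → qm q (+ k) n * pow q n ≈ pow q k
  qm-* k n rewrite ℤP.m-n≡m⊖n k n = powℤ-⊖ q≉0 k n

  b-inverse : ∀ n → b n * pow q n ≈ 1#
  b-inverse = qm-* 0

  qm≈ : ∀ k n → qm q (+ k) n ≈ pow q k * b n
  qm≈ k n = *-cancelʳ-≉0 (pow-≉0 q≉0 n) (trans (qm-* k n)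
    (sym (lincomb₁ (b-inverse n) (solve (pow q k ∷ b n ∷ pow q n ∷ []) (λ k b x →
      k :* b :* x :- k := k :* (b :* x :- :1))))))

  c≈ : ∀ n → c′ n ≈ q * b n
  c≈ n = trans (qm≈ 1 n) (*-congʳ (*-identityʳ q))

  d≈ : ∀ n → d n ≈ pow q 2 * b n
  d≈ = qm≈ 2

  weight-step : ∀ n j → weight a n (suc j) * (pow q j * (b n - Q * pow q j)) ≈
                        weight a n j * (b n * pow q j - 1#)
  weight-step n j = trans (*-congʳ (*-congˡ (reflexive (≡.cong (λ m → poch (a * q) q m ⁻¹) (ℕP.+-suc n j)))))
    (lincomb₃ (recip-qq-step n j) (b-inverse n) (weight-a-unfold n j)
      (solve (recip-qq n j ∷ recip-qq n (suc j) ∷ poch (a * q) q (suc (n ℕ.+ j)) ⁻¹ ∷ weight a n j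
             ∷ b n ∷ q ∷ pow q n ∷ pow q j ∷ [])
        (λ i i′ ρ w b q x t →
          i′ :* ρ :* (t :* (b :- q :^ 3 :* t)) :- w :* (b :* t :- :1)
          := (:- (ρ :* (b :- q :^ 3 :* t))) :* (i :* (t :- x) :- t :* i′)
             :+ i :* ρ :* (q :^ 3 :* t :* t :- :1) :* (b :* x :- :1)
             :+ (:- (b :* t :- :1)) :* (w :- i :* (ρ :* (:1 :- q :^ 3 :* x :* t))))))

  -- With t = q^j and β = `b (suc n)`, the product (β t - 1)(β - a t) expands to -β (1 + a t²) + (β²
  -- + a) t. Raising n thus multiplies the kernel by a combination of Y and T, which is what the
  -- moments can absorb.
  weight-next : ∀ n j →
    weight a (suc n) j * ((b (suc n) * pow q j - 1#) * (b (suc n) - a * pow q j)) ≈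
    b (suc n) * b (suc n) * (pow q j * weight a n j)
  weight-next n j = lincomb₃ (recip-qq-step (suc n) j) (b-inverse (suc n)) (weight-a-unfold n j)
      (solve (recip-qq (suc n) j ∷ recip-qq n j ∷ poch (a * q) q (suc (n ℕ.+ j)) ⁻¹ ∷ weight a n j
             ∷ b (suc n) ∷ q ∷ pow q n ∷ pow q j ∷ [])
        (λ i i′ ρ w b q x t →
          i :* ρ :* ((b :* t :- :1) :* (b :- q :^ 2 :* t)) :- b :* b :* (t :* w)
          := b :* b :* ρ :* (:1 :- q :^ 3 :* x :* t) :* (i :* (t :- q :* x) :- t :* i′)
             :+ i :* ρ :* (q :^ 2 :* t :* (b :* t :- :1) :+ b :- b :* q :^ 3 :* x :* t) :* (b :* (q :* x) :- :1)
             :+ (:- (b :* b :* t)) :* (w :- i′ :* (ρ :* (:1 :- q :^ 3 :* x :* t)))))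

  -- One step in base q³ is three steps in j. The three consecutive factors are the origin of the
  -- parameters q⁻ⁿ, q¹⁻ⁿ, q²⁻ⁿ.
  weight-step₃ : ∀ n j → let t = pow q j ; β = b n in
    weight a n (3 ℕ.+ j) * (Q * pow t 3 * ((β - Q * t) * (β - Q * (q * t)) * (β - Q * (q * (q * t))))) ≈
    weight a n j * ((β * t - 1#) * (β * (q * t) - 1#) * (β * (q * (q * t)) - 1#))
  weight-step₃ n j = lincomb₃ (weight-step n j) (weight-step n (1 ℕ.+ j)) (weight-step n (2 ℕ.+ j))
    (solve (weight a n j ∷ weight a n (1 ℕ.+ j) ∷ weight a n (2 ℕ.+ j) ∷ weight a n (3 ℕ.+ j) ∷ b n ∷ q ∷ pow q j ∷ [])
      (λ w₀ w₁ w₂ w₃ b q t →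
        let A₁ = t :* (b :- q :^ 3 :* t)
            A₂ = q :* t :* (b :- q :^ 3 :* (q :* t))
            A₃ = q :* (q :* t) :* (b :- q :^ 3 :* (q :* (q :* t)))
            B₀ = b :* t :- :1
            B₁ = b :* (q :* t) :- :1
            B₂ = b :* (q :* (q :* t)) :- :1
        in w₃ :* (q :^ 3 :* t :^ 3 :* ((b :- q :^ 3 :* t) :* (b :- q :^ 3 :* (q :* t)) :* (b :- q :^ 3 :* (q :* (q :* t)))))
             :- w₀ :* (B₀ :* B₁ :* B₂)
           := B₁ :* B₂ :* (w₁ :* A₁ :- w₀ :* B₀) :+ A₁ :* B₂ :* (w₂ :* A₂ :- w₁ :* B₁)
              :+ A₁ :* A₂ :* (w₃ :* A₃ :- w₂ :* B₂)))

  -- The coefficients without u and v.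

  -- What remains of `C` and `D` when the factors in u and v are removed.
  ratio : (x y : Carrier) → ℕ → Carrier
  ratio x y r = poch x Q r / (poch y Q r * pow e r)

  ratio-step : ∀ x y k → y * e ≈ k → (∀ r → poch y Q r ≉0) → ∀ r →
    ratio x y (suc r) * (e - k * pow Q r) ≈ ratio x y r * (1# - x * pow Q r)
  ratio-step x y k ye≈k y≉0 r = *-cancelʳ-≉0 (den≉0 r)
    (lincomb₃ (/-*-cancel {poch x Q r} (den≉0 r)) (/-*-cancel {poch x Q (suc r)} (den≉0 (suc r))) ye≈k
      (solve (ratio x y r ∷ ratio x y (suc r) ∷ poch x Q r ∷ poch y Q r ∷ pow e r ∷ x ∷ y ∷ e ∷ k ∷ pow Q r ∷ [])
        (λ R R′ P P′ E x y e k X →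
          R′ :* (e :- k :* X) :* (P′ :* E) :- R :* (:1 :- x :* X) :* (P′ :* E)
          := (:- (:1 :- x :* X)) :* (R :* (P′ :* E) :- P)
             :+ :1 :* (R′ :* (P′ :* (:1 :- y :* X) :* (e :* E)) :- P :* (:1 :- x :* X))
             :+ R′ :* P′ :* E :* X :* (y :* e :- k))))
    where
    den≉0 : ∀ r → (poch y Q r * pow e r) ≉0
    den≉0 r = *-≉0 (y≉0 r) (pow-≉0 e≉0 r)

  pow-Q : ∀ r → pow Q r ≈ pow q (r ℕ.* 3)
  pow-Q = pow-pow q 3

  pow-exponent₃ : ∀ r → pow q (exponent₃ (suc r)) ≈ q * (pow q (exponent₃ r) * pow (pow q (r ℕ.* 3)) 3)
  pow-exponent₃ r = *-congˡ (trans (pow-+ q (exponent₃ r) _) (*-congˡ (begin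
    pow q (r ℕ.* 3 ℕ.+ (r ℕ.* 3 ℕ.+ r ℕ.* 3)) ≈⟨ pow-+ q (r ℕ.* 3) _ ⟩
    X * pow q (r ℕ.* 3 ℕ.+ r ℕ.* 3)           ≈⟨ *-congˡ (pow-+ q (r ℕ.* 3) (r ℕ.* 3)) ⟩
    X * (X * X)                               ≈⟨ *-congˡ (*-congˡ (*-identityʳ X)) ⟨
    X * (X * (X * 1#))                        ∎)))
    where X = pow q (r ℕ.* 3)

  -- In `sD` the single q is q⁻³ from the exponent of α_{3r+1} times a² = q⁴, where u and v each
  -- contribute one a (see `D-pair`).
  sC sD s : ℕ → Carrier
  sC r = sgn r * pow q (exponent₃ r) * ratio e (pow q 5 / e) r
  sD r = sgn r * (q * (pow q (exponent₃ r) * pow q (r ℕ.* 3))) * ratio (e / a) (Q / e) (suc r)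
  s = interleave sC sD (λ _ → 0#)

  q⁵/e≉0 : ∀ r → poch (pow q 5 / e) Q r ≉0
  q⁵/e≉0 r = *-≉0ˡ (*-≉0ˡ (*-≉0ˡ (*-≉0ˡ (Cden≉0 r))))

  q³/e≉0 : ∀ r → poch (Q / e) Q r ≉0
  q³/e≉0 r = *-≉0ˡ (*-≉0ˡ (*-≉0ˡ (*-≉0ˡ (Dden≉0 r))))

  -- One relation in t = q^j serves both halves. Its factors 1 - e t and e - q⁵ t are the e-factors
  -- of `Π⁺` at t and of `Π⁻` at q³ t, and t³ compensates the power in `weight-step₃`.
  StepAt : (s s′ t : Carrier) → Set ℓ
  StepAt s s′ t = s′ * (e - pow q 5 * t) ≈ - (q * pow t 3 * (1# - e * t) * s)

  sC-step : ∀ r → StepAt (sC r) (sC (suc r)) (pow q (r ℕ.* 3))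
  sC-step r = lincomb₃ (ratio-step e (pow q 5 / e) (pow q 5) (/-*-cancel e≉0) q⁵/e≉0 r) (pow-Q r) (pow-exponent₃ r)
    (solve (sgn r ∷ pow q (exponent₃ r) ∷ pow q (exponent₃ (suc r)) ∷ ratio e (pow q 5 / e) r
           ∷ ratio e (pow q 5 / e) (suc r) ∷ pow Q r ∷ pow q (r ℕ.* 3) ∷ q ∷ e ∷ [])
      (λ s z z′ R R′ X t q e →
        (:- :1) :* s :* z′ :* R′ :* (e :- q :^ 5 :* t) :- :- (q :* t :^ 3 :* (:1 :- e :* t) :* (s :* z :* R))
        := (:- (s :* q :* z :* t :^ 3)) :* (R′ :* (e :- q :^ 5 :* X) :- R :* (:1 :- e :* X))
           :+ s :* q :* z :* t :^ 3 :* (R :* e :- R′ :* q :^ 5) :* (X :- t)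
           :+ (:- (s :* R′ :* (e :- q :^ 5 :* t))) :* (z′ :- q :* (z :* t :^ 3))))

  sD-step : ∀ r → StepAt (sD r) (sD (suc r)) (pow q (1 ℕ.+ r ℕ.* 3))
  sD-step r = lincomb₃ ratio-step′ (pow-Q r) (pow-exponent₃ r)
    (solve (sgn r ∷ pow q (exponent₃ r) ∷ pow q (exponent₃ (suc r)) ∷ ratio (e / a) (Q / e) (suc r)
           ∷ ratio (e / a) (Q / e) (suc (suc r)) ∷ pow Q r ∷ pow q (r ℕ.* 3) ∷ q ∷ e ∷ [])
      (λ s z z′ R R′ X t q e →
        (:- :1) :* s :* (q :* (z′ :* (q :* (q :* (q :* t))))) :* R′ :* (e :- q :^ 5 :* (q :* t))
          :- :- (q :* (q :* t) :^ 3 :* (:1 :- e :* (q :* t)) :* (s :* (q :* (z :* t)) :* R))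
        := (:- (s :* q :^ 5 :* z :* t :^ 4)) :* (R′ :* (e :- q :^ 6 :* X) :- R :* (:1 :- e :* q :* X))
           :+ s :* q :^ 5 :* z :* t :^ 4 :* (R :* e :* q :- R′ :* q :^ 6) :* (X :- t)
           :+ (:- (s :* q :^ 4 :* t :* R′ :* (e :- q :^ 6 :* t))) :* (z′ :- q :* (z :* t :^ 3))))
    where
    ratio-step′ : ratio (e / a) (Q / e) (suc (suc r)) * (e - pow q 6 * pow Q r) ≈
                  ratio (e / a) (Q / e) (suc r) * (1# - e * q * pow Q r)
    ratio-step′ = lincomb₂ (ratio-step (e / a) (Q / e) Q (/-*-cancel e≉0) q³/e≉0 (suc r)) (/-*-cancel {e} a≉0)
      (solve (ratio (e / a) (Q / e) (suc r) ∷ ratio (e / a) (Q / e) (suc (suc r)) ∷ pow Q r ∷ e / a ∷ q ∷ e ∷ [])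
        (λ R R′ X y q e →
          R′ :* (e :- q :^ 6 :* X) :- R :* (:1 :- e :* q :* X)
          := :1 :* (R′ :* (e :- q :^ 3 :* (q :^ 3 :* X)) :- R :* (:1 :- y :* (q :^ 3 :* X)))
             :+ (:- (R :* q :* X)) :* (y :* q :^ 2 :- e)))

  sC₀ : sC 0 ≈ 1#
  sC₀ = trans (*-congʳ (*-identityˡ 1#)) (trans (*-identityˡ _)
    (/-unique (*-≉0 1≉0 1≉0) (solve [] (:1 := :1 :* (:1 :* :1)))))

  -- The step relations fix each half only up to a constant. This initial value, relative to `sC₀`,
  -- is what lets the boundary terms cancel.
  sD₀ : sD 0 * (q * (e - Q)) ≈ a - e
  sD₀ = lincomb₃ (/-*-cancel {poch (e / a) Q 1} (*-≉0 (q³/e≉0 1) (pow-≉0 e≉0 1))) (/-*-cancel {e} a≉0) (/-*-cancel {Q} e≉0)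
    (solve (ratio (e / a) (Q / e) 1 ∷ e / a ∷ Q / e ∷ e ∷ q ∷ []) (λ R x y e q →
      :1 :* (q :* (:1 :* :1)) :* R :* (q :* (e :- q :^ 3)) :- (q :^ 2 :- e)
      := q :^ 2 :* (R :* (:1 :* (:1 :- y :* :1) :* (e :* :1)) :- :1 :* (:1 :- x :* :1))
         :+ (:- :1) :* (x :* q :^ 2 :- e)
         :+ R :* q :^ 2 :* (y :* e :- q :^ 3)))

  -- Moments of the series for fixed n.

  module At (n : ℕ) where
    open WellPoised F a (b n) (c′ n) (d n) e Q public

    Π⁻≈ : ∀ x → Π⁻ x ≈ (b n - a * x) * (q * b n - a * x) * (pow q 2 * b n - a * x) * (e - a * x)
    Π⁻≈ x = *-congʳ (*-cong (*-congˡ (+-congʳ (c≈ n))) (+-congʳ (d≈ n)))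

    Π⁺≈ : ∀ x → Π⁺ x ≈ (1# - b n * x) * (1# - q * b n * x) * (1# - pow q 2 * b n * x) * (1# - e * x)
    Π⁺≈ x = *-congʳ (*-cong (*-congˡ (+-congˡ (-‿cong (*-congʳ (c≈ n))))) (+-congˡ (-‿cong (*-congʳ (d≈ n)))))

    -- The coefficient supplies the e-factor and the kernel the factors of b, c, d. Both relations
    -- carry t³ with t = q^j, which is cancelled at the end. The remaining constant q is a² / p.
    f-step′ : ∀ s s′ j → StepAt s s′ (pow q j) →
      s′ * weight a n (3 ℕ.+ j) * Π⁻ (pow q (3 ℕ.+ j)) ≈ q * (s * weight a n j * Π⁺ (pow q j))
    f-step′ s s′ j step = *-cancelˡ-≉0 (pow-≉0 (pow-≉0 q≉0 j) 3)
      (trans (*-congˡ (*-congˡ (Π⁻≈ (pow q (3 ℕ.+ j)))))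
      (trans (lincomb₂ step (weight-step₃ n j)
        (solve (s ∷ s′ ∷ weight a n j ∷ weight a n (3 ℕ.+ j) ∷ b n ∷ q ∷ pow q j ∷ e ∷ []) (λ s s′ w w′ b q t e →
          let t₃ = q :* (q :* (q :* t))
              A  = q :^ 3 :* t :^ 3 :* ((b :- q :^ 3 :* t) :* (b :- q :^ 3 :* (q :* t)) :* (b :- q :^ 3 :* (q :* (q :* t))))
              B  = (b :* t :- :1) :* (b :* (q :* t) :- :1) :* (b :* (q :* (q :* t)) :- :1)
          in t :^ 3 :* (s′ :* w′ :* ((b :- q :^ 2 :* t₃) :* (q :* b :- q :^ 2 :* t₃) :* (q :^ 2 :* b :- q :^ 2 :* t₃) :* (e :- q :^ 2 :* t₃)))
             :- t :^ 3 :* (q :* (s :* w :* ((:1 :- b :* t) :* (:1 :- q :* b :* t) :* (:1 :- q :^ 2 :* b :* t) :* (:1 :- e :* t))))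
             := w :* B :* (s′ :* (e :- q :^ 5 :* t) :- :- (q :* t :^ 3 :* (:1 :- e :* t) :* s))
                :+ s′ :* (e :- q :^ 5 :* t) :* (w′ :* A :- w :* B))))
      (sym (*-congˡ (*-congˡ (*-congˡ (Π⁺≈ (pow q j))))))))

    xC xD fC fD : ℕ → Carrier
    xC r = pow q (r ℕ.* 3)
    xD r = pow q (1 ℕ.+ r ℕ.* 3)
    fC r = sC r * weight a n (r ℕ.* 3)
    fD r = sD r * weight a n (1 ℕ.+ r ℕ.* 3)

    pow-step : ∀ t → q * (q * (q * t)) ≈ Q * t
    pow-step t = solve (q ∷ t ∷ []) (λ q t → q :* (q :* (q :* t)) := q :^ 3 :* t)

    Q*q≈a² : Q * q ≈ a * a
    Q*q≈a² = solve (q ∷ []) (λ q → q :^ 3 :* q := q :^ 2 :* q :^ 2)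

    halfC : Half q xC fC
    halfC = record { pk≈a² = Q*q≈a² ; x-step = λ r → pow-step _
                   ; f-step = λ r → f-step′ (sC r) (sC (suc r)) (r ℕ.* 3) (sC-step r) }

    halfD : Half q xD fD
    halfD = record { pk≈a² = Q*q≈a² ; x-step = λ r → pow-step _
                   ; f-step = λ r → f-step′ (sD r) (sD (suc r)) (1 ℕ.+ r ℕ.* 3) (sD-step r) }

    n<3+3n : ∀ k → n < k ℕ.+ suc n ℕ.* 3
    n<3+3n k = ℕP.≤-trans (ℕP.m≤m*n (suc n) 3) (ℕP.m≤n+m (suc n ℕ.* 3) k)

    fC≈0 : fC (suc n) ≈ 0#
    fC≈0 = trans (*-congˡ (weight-> a (n<3+3n 0))) (zeroʳ _)

    fD≈0 : fD (suc n) ≈ 0#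
    fD≈0 = trans (*-congˡ (weight-> a (n<3+3n 1))) (zeroʳ _)

    -- Both terms contain q³ (b - q²)(b - q). In the second one, `weight-step` at j = 0 replaces b -
    -- q³ by b - 1 and `sD₀` replaces q (e - q³) by q² - e, which gives the negative of the first.
    G₁-boundary : G₁ xC fC 0 + G₁ xD fD 0 ≈ 0#
    G₁-boundary = trans (+-cong (*-congˡ (*-congˡ (Π⁻≈ 1#))) (*-congˡ (*-congˡ (Π⁻≈ (q * 1#)))))
      (lincomb₃ sC₀ sD₀ (weight-step n 0)
        (solve (sC 0 ∷ sD 0 ∷ weight a n 0 ∷ weight a n 1 ∷ b n ∷ q ∷ e ∷ [])
          (λ s s′ w w′ b q e →
            let P  = λ x → (b :- q :^ 2 :* x) :* (q :* b :- q :^ 2 :* x) :* (q :^ 2 :* b :- q :^ 2 :* x) :* (e :- q :^ 2 :* x)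
                R  = (b :- q :^ 2) :* (b :- q) :* q :^ 3
            in s :* w :* (:1 :* P :1) :+ s′ :* w′ :* (q :* :1 :* P (q :* :1)) :- :0
               := w :* P :1 :* (s :- :1) :+ w :* (b :- :1) :* R :* (s′ :* (q :* (e :- q :^ 3)) :- (q :^ 2 :- e))
                  :+ s′ :* R :* q :* (e :- q :^ 3) :* (w′ :* (:1 :* (b :- q :^ 3 :* :1)) :- w :* (b :* :1 :- :1)))))

    -- At both initial points, x = 1 and x = q, the factor p + a x² equals (q³ + q²) x, so the claim
    -- is a multiple of the previous one.
    G₂-boundary : G₂ xC fC 0 + G₂ xD fD 0 ≈ 0#
    G₂-boundary = lincomb₁ G₁-boundary
      (solve (fC 0 ∷ fD 0 ∷ Π⁻ (xC 0) ∷ Π⁻ (xD 0) ∷ q ∷ []) (λ f f′ P P′ q →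
        f :* ((q :^ 3 :+ q :^ 2 :* (:1 :* :1)) :* P) :+ f′ :* ((q :^ 3 :+ q :^ 2 :* (q :* :1 :* (q :* :1))) :* P′) :- :0
        := (q :^ 3 :+ q :^ 2) :* (f :* (:1 :* P) :+ f′ :* (q :* :1 :* P′) :- :0)))

    M : (Carrier → Carrier) → Carrier
    M m = sumTo (λ j → s j * weight a n j * m (pow q j)) n

    M-cong : ∀ m m′ → (∀ x → m x ≈ m′ x) → M m ≈ M m′
    M-cong m m′ m≈m′ = sumTo-cong n (λ j _ → *-congˡ (m≈m′ (pow q j)))

    M-linear : ∀ k l m m′ → M (λ x → k * m x + l * m′ x) ≈ k * M m + l * M m′
    M-linear k l m m′ = begin
      M (λ x → k * m x + l * m′ x)
        ≈⟨ sumTo-cong n (λ j _ → solve (s j * weight a n j ∷ k ∷ l ∷ m (pow q j) ∷ m′ (pow q j) ∷ [])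
             (λ w k l x y → w :* (k :* x :+ l :* y) := k :* (w :* x) :+ l :* (w :* y))) ⟩
      sumTo (λ j → k * (s j * weight a n j * m (pow q j)) + l * (s j * weight a n j * m′ (pow q j))) n
        ≈⟨ sumTo-+ _ _ n ⟩
      sumTo (λ j → k * (s j * weight a n j * m (pow q j))) n + sumTo (λ j → l * (s j * weight a n j * m′ (pow q j))) n
        ≈⟨ +-cong (sumTo-*ˡ k _ n) (sumTo-*ˡ l _ n) ⟩
      k * M m + l * M m′ ∎

    M-linear₃ : ∀ k l h m m′ m″ → M (λ x → k * m x + l * m′ x + h * m″ x) ≈ k * M m + l * M m′ + h * M m″
    M-linear₃ k l h m m′ m″ = begin
      M (λ x → k * m x + l * m′ x + h * m″ x)
        ≈⟨ M-cong _ (λ x → k * m x + l * m′ x + h * m″ x) (λ x → +-congʳ (*-identityˡ _)) ⟨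
      M (λ x → 1# * (k * m x + l * m′ x) + h * m″ x)
        ≈⟨ M-linear 1# h (λ x → k * m x + l * m′ x) m″ ⟩
      1# * M (λ x → k * m x + l * m′ x) + h * M m″
        ≈⟨ +-congʳ (trans (*-identityˡ _) (M-linear k l m m′)) ⟩
      k * M m + l * M m′ + h * M m″ ∎

    -- The range is padded to 3n + 2 so that it splits into complete triples of residues. The added
    -- terms vanish with the kernel, and those of residue 2 vanish with `s`.
    M-halves : ∀ m → M m ≈ sumTo (λ r → fC r * m (xC r) + fD r * m (xD r)) n
    M-halves m = begin
      M m
        ≈⟨ sumTo-extend g n (2 ℕ.+ n ℕ.* 2) (λ j n<j →
             trans (*-congʳ (trans (*-congˡ (weight-> a n<j)) (zeroʳ _))) (zeroˡ _)) ⟨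
      sumTo g (2 ℕ.+ n ℕ.* 2 ℕ.+ n)
        ≡⟨ ≡.cong (sumTo g ∘ (2 ℕ.+_)) (≡.trans (ℕP.+-comm (n ℕ.* 2) n) (≡.sym (ℕP.*-suc n 2))) ⟩
      sumTo g (2 ℕ.+ n ℕ.* 3)
        ≈⟨ sumTo-thirds g n ⟩
      sumTo (λ r → g (r ℕ.* 3) + g (1 ℕ.+ r ℕ.* 3) + g (2 ℕ.+ r ℕ.* 3)) n
        ≈⟨ sumTo-cong n (λ r _ → byThirds r) ⟩
      sumTo (λ r → fC r * m (xC r) + fD r * m (xD r)) n ∎
      where
      g : ℕ → Carrier
      g j = s j * weight a n j * m (pow q j)
      byThirds : ∀ r → g (r ℕ.* 3) + g (1 ℕ.+ r ℕ.* 3) + g (2 ℕ.+ r ℕ.* 3) ≈ fC r * m (xC r) + fD r * m (xD r)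
      byThirds r rewrite interleave-0 sC sD (λ _ → 0#) r | interleave-1 sC sD (λ _ → 0#) r
                    | interleave-2 sC sD (λ _ → 0#) r =
        trans (+-congˡ (trans (*-congʳ (zeroˡ _)) (zeroˡ _))) (+-identityʳ _)

    open TwoHalves halfC halfD n fC≈0 fD≈0

    M₁-relation : (a * a - σ₄) * M m₁ + a * (σ₃ - a * σ₁) * M m₀ ≈ 0#
    M₁-relation = trans (sym (M-linear _ _ m₁ m₀)) (trans (M-halves lin₁) (sum-lin₁ G₁-boundary))

    M₂-relation : (a * a - Q * σ₄) * M m₂ + a * (Q * σ₃ - a * σ₁) * M m₁
                + - ((1# - Q) * a * (a * a - σ₂ * a + σ₄)) * M m₀ ≈ 0#
    M₂-relation = begin
      _ ≈⟨ M-linear₃ _ _ _ m₂ m₁ m₀ ⟨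
      _ ≈⟨ M-cong _ lin₂ (λ x → +-congˡ (sym (-‿distribˡ-* _ _))) ⟩
      M lin₂ ≈⟨ M-halves lin₂ ⟩
      _ ≈⟨ sum-lin₂ G₂-boundary ⟩
      0# ∎
      where open RingProperties ring using (-‿distribˡ-*)

    M-num : (u v : Carrier) →
      (a * a - σ₄) * (a * a - Q * σ₄) *
        (u * v * M m₂ + - ((u + v) * (a + u * v)) * M m₁ + (u * u + a) * (v * v + a) * M m₀) ≈
      (u * v * (σ₃ - a * σ₁) * (Q * σ₃ - a * σ₁) * (a * a)
        + (1# - Q) * u * v * (a * a - σ₄) * (a * a - σ₂ * a + σ₄) * a
        + (u + v) * (a + u * v) * (σ₃ - a * σ₁) * (a * a - Q * σ₄) * a
        + (u * u + a) * (v * v + a) * (a * a - σ₄) * (a * a - Q * σ₄)) * M m₀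
    M-num u v = lincomb₂ M₁-relation M₂-relation
      (solve (u ∷ v ∷ a ∷ Q ∷ σ₁ ∷ σ₂ ∷ σ₃ ∷ σ₄ ∷ M m₀ ∷ M m₁ ∷ M m₂ ∷ []) (λ u v a p s₁ s₂ s₃ s₄ M₀ M₁ M₂ →
        (a :* a :- s₄) :* (a :* a :- p :* s₄) :*
          (u :* v :* M₂ :+ (:- ((u :+ v) :* (a :+ u :* v))) :* M₁ :+ (u :* u :+ a) :* (v :* v :+ a) :* M₀)
        :- (u :* v :* (s₃ :- a :* s₁) :* (p :* s₃ :- a :* s₁) :* (a :* a)
             :+ (:1 :- p) :* u :* v :* (a :* a :- s₄) :* (a :* a :- s₂ :* a :+ s₄) :* a
             :+ (u :+ v) :* (a :+ u :* v) :* (s₃ :- a :* s₁) :* (a :* a :- p :* s₄) :* a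
             :+ (u :* u :+ a) :* (v :* v :+ a) :* (a :* a :- s₄) :* (a :* a :- p :* s₄)) :* M₀
        -- The second relation removes M₂. The multiplier of the first is then the coefficient left
        -- at M₁, divided by a² - σ₄.
        := (:- ((u :+ v) :* (a :+ u :* v) :* (a :* a :- p :* s₄) :+ u :* v :* a :* (p :* s₃ :- a :* s₁)))
             :* ((a :* a :- s₄) :* M₁ :+ a :* (s₃ :- a :* s₁) :* M₀ :- :0)
           :+ (a :* a :- s₄) :* u :* v
             :* ((a :* a :- p :* s₄) :* M₂ :+ a :* (p :* s₃ :- a :* s₁) :* M₁
                 :+ (:- ((:1 :- p) :* a :* (a :* a :- s₂ :* a :+ s₄))) :* M₀ :- :0)))

  -- Evaluation of the zeroth moment.

  M₀ M₁ : ℕ → Carrier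
  M₀ n = At.M n (At.m₀ n)
  M₁ n = At.M n (At.m₁ n)

  M₀-next : ∀ n → let β = b (suc n) in
    β * β * M₀ n ≈ - β * M₁ (suc n) + (β * β + a) * M₀ (suc n)
  M₀-next n = begin
    β * β * M₀ n
      ≈⟨ sumTo-*ˡ (β * β) (term n) n ⟨
    sumTo (λ j → β * β * term n j) n
      ≈⟨ sumTo-extend (λ j → β * β * term n j) n 1 (λ j n<j → trans (*-congˡ
           (trans (*-congʳ (trans (*-congˡ (weight-> a n<j)) (zeroʳ _))) (zeroˡ _))) (zeroʳ _)) ⟨
    sumTo (λ j → β * β * term n j) (suc n)
      ≈⟨ sumTo-cong (suc n) (λ j _ → lincomb₁ (weight-next n j)
           (solve (weight a n j ∷ weight a (suc n) j ∷ s j ∷ β ∷ a ∷ pow q j ∷ []) (λ w w′ s b a t →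
             let k = :1 :- a :* (t :* t) in
             b :* b :* (s :* w :* (k :* (t :* t)))
               :- s :* w′ :* ((:- b) :* (k :* (t :* (:1 :+ a :* (t :* t)))) :+ (b :* b :+ a) :* (k :* (t :* t)))
             := (:- (s :* k :* t)) :* (w′ :* ((b :* t :- :1) :* (b :- a :* t)) :- b :* b :* (t :* w))))) ⟩
    At.M (suc n) (λ x → - β * At.m₁ (suc n) x + (β * β + a) * At.m₀ (suc n) x)
      ≈⟨ At.M-linear (suc n) (- β) (β * β + a) (At.m₁ (suc n)) (At.m₀ (suc n)) ⟩
    - β * M₁ (suc n) + (β * β + a) * M₀ (suc n) ∎
    where
    β = b (suc n)
    term : ℕ → ℕ → Carrier
    term n j = s j * weight a n j * At.m₀ n (pow q j)

  -- M₁ is eliminated from `M₀-next`. Because β is the parameter b itself, the resulting coefficient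
  -- (β² + a)(a² - σ₄) + a β (σ₃ - a σ₁) of M₀ factors completely.
  M₀-recurrence : ∀ n → let β = b (suc n) in
    M₀ (suc n) * ((a - β * c′ (suc n)) * (a - β * d (suc n)) * (a - β * e)) ≈
    β * β * (a * a - At.σ₄ (suc n)) * M₀ n
  M₀-recurrence n = lincomb₂ (M₀-next n) (At.M₁-relation (suc n))
    (solve (M₀ n ∷ M₀ (suc n) ∷ M₁ (suc n) ∷ a ∷ b (suc n) ∷ c′ (suc n) ∷ d (suc n) ∷ e ∷ [])
      (λ N₀ M₀ M₁ a b c d e →
        let s₁ = b :+ c :+ d :+ e
            s₃ = b :* c :* d :+ b :* c :* e :+ b :* d :* e :+ c :* d :* e
            s₄ = b :* c :* d :* e
        in M₀ :* ((a :- b :* c) :* (a :- b :* d) :* (a :- b :* e)) :- b :* b :* (a :* a :- s₄) :* N₀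
           := (:- (a :* a :- s₄)) :* (b :* b :* N₀ :- ((:- b) :* M₁ :+ (b :* b :+ a) :* M₀))
              :+ b :* ((a :* a :- s₄) :* M₁ :+ a :* (s₃ :- a :* s₁) :* M₀ :- :0)))

  βden : ℕ → Carrier
  βden n = poch a q (2 ℕ.* n) * poch (Q / e) q n

  Δ : ℕ → Carrier
  Δ n = (1# - a * q * (pow q n * pow q n)) * (1# - a * (pow q n * pow q n)) * (1# - Q / e * pow q n)

  pow-2* : ∀ n → pow q (2 ℕ.* n) ≈ pow q n * pow q n
  pow-2* n = trans (pow-+ q n (n ℕ.+ 0)) (*-congˡ (reflexive (≡.cong (pow q) (ℕP.+-identityʳ n))))

  pow-Q′ : ∀ n → pow Q n ≈ pow (pow q n) 3
  pow-Q′ n = trans (pow-pow q 3 n) (trans (reflexive (≡.cong (pow q) (ℕP.*-comm n 3))) (sym (pow-pow q n 3)))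

  βden-step : ∀ n → βden (suc n) ≈ βden n * Δ n
  βden-step n = trans (*-congʳ (reflexive (≡.cong (poch a q) (ℕP.*-suc 2 n))))
    (lincomb₁ (pow-2* n)
      (solve (poch a q (2 ℕ.* n) ∷ poch (Q / e) q n ∷ a ∷ Q / e ∷ q ∷ pow q n ∷ pow q (2 ℕ.* n) ∷ [])
        (λ P R a g q x y →
          P :* (:1 :- a :* y) :* (:1 :- a :* (q :* y)) :* (R :* (:1 :- g :* x))
            :- P :* R :* ((:1 :- a :* q :* (x :* x)) :* (:1 :- a :* (x :* x)) :* (:1 :- g :* x))
          := P :* R :* (:1 :- g :* x) :* (a :* a :* q :* (y :+ x :* x) :- a :- a :* q) :* (y :- x :* x))))

  Δ≉0 : ∀ n → Δ n ≉0
  Δ≉0 n = *-≉0ʳ (≉0-resp (βden-step n) (βden≉0 (suc n)))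

  βfac-step : ∀ n → βfac e q (suc n) * Δ n ≈ βfac e q n * (1# - pow q 4 / e * pow (pow q n) 3)
  βfac-step n = *-cancelʳ-≉0 (βden≉0 n) (trans
    (lincomb₂ (trans (*-congˡ (sym (βden-step n))) (/-*-cancel {poch (pow q 4 / e) Q (suc n)} (βden≉0 (suc n))))
              (/-*-cancel {poch (pow q 4 / e) Q n} (βden≉0 n))
      (solve (βfac e q n ∷ βfac e q (suc n) ∷ Δ n ∷ βden n ∷ poch (pow q 4 / e) Q n ∷ 1# - pow q 4 / e * pow Q n ∷ [])
        (λ B B′ D E P y → B′ :* D :* E :- B :* y :* E
          := :1 :* (B′ :* (E :* D) :- P :* y) :+ (:- y) :* (B :* E :- P))))
    (*-congʳ (*-congˡ (+-congˡ (-‿cong (*-congˡ (pow-Q′ n)))))))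

  M₀-zero : M₀ 0 ≈ 1# - a
  M₀-zero = lincomb₂ sC₀ weight₀ (solve (sC 0 ∷ weight a 0 0 ∷ a ∷ []) (λ s w a →
    s :* w :* ((:1 :- a :* (:1 :* :1)) :* (:1 :* :1)) :- (:1 :- a)
    := w :* (:1 :- a) :* (s :- :1) :+ (:1 :- a) :* (w :- :1)))
    where
    weight₀ : weight a 0 0 ≈ 1#
    weight₀ = trans (*-cong (⁻¹-unique 1≉0 (*-identityʳ 1#)) (⁻¹-unique 1≉0 (*-identityʳ 1#))) (*-identityʳ 1#)

  -- By β q^(n+1) = 1 each factor of the recurrence becomes a monomial times a factor of the claim.
  -- The monomials -q β², -q² β², -β e on one side and β², -q³ β³ e on the other have the same
  -- product κ, which cancels.
  M₀-step : ∀ n → M₀ (suc n) * Δ n ≈ M₀ n * (1# - pow q 4 / e * pow (pow q n) 3)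
  M₀-step n = *-cancelˡ-≉0 κ≉0 (begin
    κ * (M₀ (suc n) * Δ n)
      ≈⟨ solve (M₀ (suc n) ∷ β ∷ q ∷ e ∷ 1# - a * q * (pow q n * pow q n) ∷ 1# - a * (pow q n * pow q n)
           ∷ 1# - Q / e * pow q n ∷ [])
         (λ M b q e x y z → (:- (q :^ 3 :* b :^ 5 :* e)) :* (M :* (x :* y :* z))
           := M :* ((:- (q :* b :* b :* x)) :* (:- (q :^ 2 :* b :* b :* y)) :* (:- (b :* e :* z)))) ⟩
    M₀ (suc n) * (- (q * β * β * (1# - a * q * (pow q n * pow q n))) *
      - (pow q 2 * β * β * (1# - a * (pow q n * pow q n))) * - (β * e * (1# - Q / e * pow q n)))
      ≈⟨ *-congˡ (*-cong (*-cong x₁ x₂) x₃) ⟨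
    M₀ (suc n) * ((a - β * c′ (suc n)) * (a - β * d (suc n)) * (a - β * e))
      ≈⟨ M₀-recurrence n ⟩
    β * β * (a * a - At.σ₄ (suc n)) * M₀ n
      ≈⟨ *-congʳ (*-congˡ x₄) ⟩
    β * β * - (q * q * q * β * β * β * e * (1# - pow q 4 / e * pow (pow q n) 3)) * M₀ n
      ≈⟨ solve (M₀ n ∷ β ∷ q ∷ e ∷ 1# - pow q 4 / e * pow (pow q n) 3 ∷ []) (λ M b q e x →
           b :* b :* (:- (q :* q :* q :* b :* b :* b :* e :* x)) :* M
           := (:- (q :^ 3 :* b :^ 5 :* e)) :* (M :* x)) ⟩
    κ * (M₀ n * (1# - pow q 4 / e * pow (pow q n) 3)) ∎)
    where
    β κ : Carrier
    β = b (suc n)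
    κ = - (pow q 3 * pow β 5 * e)

    κ≉0 : κ ≉0
    κ≉0 κ≈0 = *-≉0 (*-≉0 (pow-≉0 q≉0 3) (pow-≉0 (powℤ-≉0 q≉0 (+ 0 ℤ.- + suc n)) 5)) e≉0
      (trans (solve (pow q 3 * pow β 5 * e ∷ []) (λ k → k := :- (:- k))) (trans (-‿cong κ≈0) -0#≈0#))
      where open RingProperties ring using (-0#≈0#)

    x₁ : a - β * c′ (suc n) ≈ - (q * β * β * (1# - a * q * (pow q n * pow q n)))
    x₁ = lincomb₂ (c≈ (suc n)) (b-inverse (suc n))
      (solve (β ∷ c′ (suc n) ∷ q ∷ pow q n ∷ []) (λ b c q x →
        q :^ 2 :- b :* c :- :- (q :* b :* b :* (:1 :- q :^ 2 :* q :* (x :* x)))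
        := (:- b) :* (c :- q :* b) :+ (:- (q :^ 2 :* (b :* (q :* x) :+ :1))) :* (b :* (q :* x) :- :1)))

    x₂ : a - β * d (suc n) ≈ - (pow q 2 * β * β * (1# - a * (pow q n * pow q n)))
    x₂ = lincomb₂ (d≈ (suc n)) (b-inverse (suc n))
      (solve (β ∷ d (suc n) ∷ q ∷ pow q n ∷ []) (λ b d q x →
        q :^ 2 :- b :* d :- :- (q :^ 2 :* b :* b :* (:1 :- q :^ 2 :* (x :* x)))
        := (:- b) :* (d :- q :^ 2 :* b) :+ (:- (q :^ 2 :* (b :* (q :* x) :+ :1))) :* (b :* (q :* x) :- :1)))

    x₃ : a - β * e ≈ - (β * e * (1# - Q / e * pow q n))
    x₃ = lincomb₂ (/-*-cancel {Q} e≉0) (b-inverse (suc n))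
      (solve (β ∷ e ∷ Q / e ∷ q ∷ pow q n ∷ []) (λ b e g q x →
        q :^ 2 :- b :* e :- :- (b :* e :* (:1 :- g :* x))
        := (:- (b :* x)) :* (g :* e :- q :^ 3) :+ (:- (q :^ 2)) :* (b :* (q :* x) :- :1)))

    x₄ : a * a - At.σ₄ (suc n) ≈ - (q * q * q * β * β * β * e * (1# - pow q 4 / e * pow (pow q n) 3))
    x₄ = trans (+-congˡ (-‿cong (*-congʳ (*-cong (*-congˡ (c≈ (suc n))) (d≈ (suc n))))))
      (lincomb₂ (/-*-cancel {pow q 4} e≉0) (b-inverse (suc n))
        (solve (β ∷ e ∷ pow q 4 / e ∷ q ∷ pow q n ∷ []) (λ b e g q x →
          q :^ 2 :* q :^ 2 :- b :* (q :* b) :* (q :^ 2 :* b) :* e :- :- (q :* q :* q :* b :* b :* b :* e :* (:1 :- g :* x :^ 3))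
          := (:- (q :^ 3 :* b :^ 3 :* x :^ 3)) :* (g :* e :- q :^ 4)
             :+ (:- (q :^ 4 :* ((b :* (q :* x)) :^ 2 :+ b :* (q :* x) :+ :1))) :* (b :* (q :* x) :- :1))))

  M₀-value : ∀ n → M₀ n ≈ (1# - a) * βfac e q n
  M₀-value zero = trans M₀-zero (sym (trans (*-congˡ (/-unique (βden≉0 0)
    (solve [] (:1 := :1 :* (:1 :* :1))))) (*-identityʳ _)))
  M₀-value (suc n) = *-cancelʳ-≉0 (Δ≉0 n) (lincomb₃ (M₀-step n) (M₀-value n) (βfac-step n)
    (solve (M₀ n ∷ M₀ (suc n) ∷ Δ n ∷ 1# - a ∷ βfac e q n ∷ βfac e q (suc n) ∷ 1# - pow q 4 / e * pow (pow q n) 3 ∷ [])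
      (λ M M′ D k B B′ y → M′ :* D :- k :* B′ :* D
        := :1 :* (M′ :* D :- M :* y) :+ y :* (M :- k :* B) :+ (:- k) :* (B′ :* D :- B :* y))))

  -- The contribution of the parameters u and v.

  -- For x ≠ 0 this is x (1 - x t)(1 - a t / x), expanded so that it is linear in Y and T.
  Φ : Carrier → Carrier → Carrier
  Φ x t = x * (1# + a * (t * t)) - (x * x + a) * t

  uvDen : Carrier
  uvDen = (1# - u) * (a - u) * ((1# - v) * (a - v))

  C-pair : ∀ {x} → x ≉0 → ∀ r →
    poch (Q * x) Q r * poch (pow q 5 / x) Q r * ((1# - x) * (a - x)) ≈
    - (1# * (poch x Q r * poch (pow q 2 / x) Q r * Φ x (pow Q r)))
  C-pair {x} x≉0 r = trans (*-congʳ (*-congˡ (poch-cong Q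
      (solve (q ∷ x ⁻¹ ∷ []) (λ q i → q :^ 5 :* i := q :^ 3 :* (q :^ 2 :* i))) r)))
    (lincomb₂ (poch-pair-shift x (a / x) Q r) (/-*-cancel {a} x≉0)
      (solve (poch (Q * x) Q r ∷ poch (Q * (a / x)) Q r ∷ poch x Q r ∷ poch (a / x) Q r ∷ x ∷ a / x ∷ a ∷ pow Q r ∷ [])
        (λ U U′ l l′ x y a t →
          U :* U′ :* ((:1 :- x) :* (a :- x)) :- :- (:1 :* (l :* l′ :* (x :* (:1 :+ a :* (t :* t)) :- (x :* x :+ a) :* t)))
          := (:- x) :* (U :* U′ :* ((:1 :- x) :* (:1 :- y)) :- l :* l′ :* ((:1 :- x :* t) :* (:1 :- y :* t)))
             :+ (l :* l′ :* t :* (:1 :- x :* t) :- U :* U′ :* (:1 :- x)) :* (y :* x :- a))))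

  -- Here `poch-pair-shift` is applied to x / a and 1 / x at index r + 1. Since q³ / a = q, the
  -- final factors are those of `Φ x` at q^(3r+1), just as `C-pair` has them at q^(3r): the
  -- multiplier is the same function of q^j on both halves.
  D-pair : ∀ {x} → x ≉0 → ∀ r →
    poch (q * x) Q (suc r) * poch (Q / x) Q (suc r) * ((1# - x) * (a - x)) ≈
    - (a * (poch (x / a) Q (suc r) * poch (1# / x) Q (suc r) * Φ x (q * pow Q r)))
  D-pair {x} x≉0 r = trans (*-congʳ (*-cong
      (poch-cong Q (lincomb₁ (/-*-cancel {x} a≉0) (solve (q ∷ x ∷ x / a ∷ []) (λ q x y →
        q :* x :- q :^ 3 :* y := (:- q) :* (y :* q :^ 2 :- x)))) (suc r))
      (poch-cong Q (solve (Q ∷ x ⁻¹ ∷ []) (λ Q i → Q :* i := Q :* (:1 :* i))) (suc r))))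
    (lincomb₃ (poch-pair-shift (x / a) (1# / x) Q (suc r)) (/-*-cancel {1#} x≉0) (/-*-cancel {x} a≉0)
      (solve (poch (Q * (x / a)) Q (suc r) ∷ poch (Q * (1# / x)) Q (suc r) ∷ poch (x / a) Q (suc r)
             ∷ poch (1# / x) Q (suc r) ∷ x ∷ x / a ∷ 1# / x ∷ q ∷ pow Q r ∷ [])
        (λ U U′ l l′ x z y q t →
          let a = q :^ 2
              X = q :^ 3 :* t
              T = q :* t
          in U :* U′ :* ((:1 :- x) :* (a :- x))
               :- :- (a :* (l :* l′ :* (x :* (:1 :+ a :* (T :* T)) :- (x :* x :+ a) :* T)))
             := (:- (a :* x)) :* (U :* U′ :* ((:1 :- z) :* (:1 :- y)) :- l :* l′ :* ((:1 :- z :* X) :* (:1 :- y :* X)))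
                :+ a :* (l :* l′ :* (:1 :- z :* X) :* X :- U :* U′ :* (:1 :- z)) :* (y :* x :- :1)
                :+ (U :* U′ :* (:1 :- x) :+ l :* l′ :* X :* (x :- X)) :* (z :* a :- x))))

  -- Used with k = 1 for `C` and k = a for `D`, hence the idle factors 1 in the statements for `C`.
  -- The signs from u and v cancel.
  wellPoised-quotient : ∀ {A A′ E U U′ V V′ l l′ m m′ φ ψ f g k} → (A′ * l * m * l′ * m′ * E) ≉0 →
    U * U′ * f ≈ - (k * (l * l′ * φ)) → V * V′ * g ≈ - (k * (m * m′ * ψ)) →
    A * U * V * U′ * V′ / (A′ * l * m * l′ * m′ * E) * (f * g) ≈ k * k * (A / (A′ * E)) * (φ * ψ)
  wellPoised-quotient {A} {A′} {E} {U} {U′} {V} {V′} {l} {l′} {m} {m′} {φ} {ψ} {f} {g} {k} den≉0 hᵤ hᵥ =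
    *-cancelʳ-≉0 den≉0 (lincomb₃ (/-*-cancel {A * U * V * U′ * V′} den≉0) (/-*-cancel {A} A′E≉0) (*-cong hᵤ hᵥ)
      (solve (A ∷ A′ ∷ E ∷ U ∷ U′ ∷ V ∷ V′ ∷ l ∷ l′ ∷ m ∷ m′ ∷ φ ∷ ψ ∷ f ∷ g ∷ k
             ∷ A * U * V * U′ * V′ / (A′ * l * m * l′ * m′ * E) ∷ A / (A′ * E) ∷ [])
        (λ A A′ E U U′ V V′ l l′ m m′ φ ψ f g k R S →
          R :* (f :* g) :* (A′ :* l :* m :* l′ :* m′ :* E) :- k :* k :* S :* (φ :* ψ) :* (A′ :* l :* m :* l′ :* m′ :* E)
          := f :* g :* (R :* (A′ :* l :* m :* l′ :* m′ :* E) :- A :* U :* V :* U′ :* V′)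
             :+ (:- (k :* k :* φ :* ψ :* l :* m :* l′ :* m′)) :* (S :* (A′ :* E) :- A)
             :+ A :* (U :* U′ :* f :* (V :* V′ :* g) :- (:- (k :* (l :* l′ :* φ))) :* (:- (k :* (m :* m′ :* ψ)))))))
    where
    A′E≉0 : (A′ * E) ≉0
    A′E≉0 = *-≉0 (*-≉0ˡ (*-≉0ˡ (*-≉0ˡ (*-≉0ˡ (*-≉0ˡ den≉0))))) (*-≉0ʳ den≉0)

  C-value : ∀ r → C e u v q r * uvDen ≈ 1# * 1# * ratio e (pow q 5 / e) r * (Φ u (pow Q r) * Φ v (pow Q r))
  C-value r = wellPoised-quotient (*-≉0 (Cden≉0 r) (pow-≉0 e≉0 r)) (C-pair u≉0 r) (C-pair v≉0 r)

  D-value : ∀ r → D e u v q (suc r) * uvDen ≈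
    a * a * ratio (e / a) (Q / e) (suc r) * (Φ u (q * pow Q r) * Φ v (q * pow Q r))
  D-value r = wellPoised-quotient (*-≉0 (Dden≉0 (suc r)) (pow-≉0 e≉0 (suc r))) (D-pair u≉0 r) (D-pair v≉0 r)

  -- Powers of q in the sequences, and the common sequence δ.

  -- The linear coefficients -7, -1, 5, -13 are -7 + 6k for k = 0, 1, 2, -1. All exponents are
  -- thereby `exponent₃ r` plus a multiple of 3r and a constant.
  ex-exponent₃ : ∀ k t r → ex (ℤ.- + 7 ℤ.+ k ℤ.* + 6) t r ≡ + exponent₃ r ℤ.+ k ℤ.* + (r ℕ.* 3) ℤ.+ t
  ex-exponent₃ k t r = ≡.cong (ℤ._+ t) (≡.trans (≡.cong (ℤD._/ + 2) even) (i*2/2≡i (+ exponent₃ r ℤ.+ k ℤ.* + (r ℕ.* 3))))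
    where
    open RingSolver ℤP.+-*-commutativeRing renaming (solve to solveℤ)
    even : + 9 ℤ.* + r ℤ.* + r ℤ.+ (ℤ.- + 7 ℤ.+ k ℤ.* + 6) ℤ.* + r ≡
           (+ exponent₃ r ℤ.+ k ℤ.* + (r ℕ.* 3)) ℤ.* + 2
    even = ≡.trans (solveℤ (+ r ∷ k ∷ + 9 ∷ ℤ.- + 7 ∷ [])
             (λ r k n s → let 3′ = :1 :+ (:1 :+ :1) in
               n :* r :* r :+ (s :+ k :* (3′ :+ 3′)) :* r := n :* r :* r :+ s :* r :+ k :* (r :* 3′) :* (:1 :+ :1)))
      (≡.trans (≡.cong₂ (λ x y → x ℤ.+ k ℤ.* y ℤ.* + 2) (ex-double r) (≡.sym (ℤP.pos-* r 3)))
        (≡.sym (ℤP.*-distribʳ-+ (+ 2) (+ exponent₃ r) (k ℤ.* + (r ℕ.* 3)))))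

  ε X : ℕ → Carrier
  ε r = pow q (exponent₃ r)
  X r = pow q (r ℕ.* 3)

  powℤ-ex : ∀ k t r → powℤ q (ex (ℤ.- + 7 ℤ.+ k ℤ.* + 6) t r) ≈ ε r * powℤ q (k ℤ.* + (r ℕ.* 3)) * powℤ q t
  powℤ-ex k t r = trans (reflexive (≡.cong (powℤ q) (ex-exponent₃ k t r)))
    (trans (powℤ-+ q≉0 (+ exponent₃ r ℤ.+ k ℤ.* + (r ℕ.* 3)) t) (*-congʳ (powℤ-+ q≉0 (+ exponent₃ r) (k ℤ.* + (r ℕ.* 3)))))

  powℤ-0* : ∀ i → powℤ q (+ 0 ℤ.* i) ≈ 1#
  powℤ-0* i rewrite ℤP.*-zeroˡ i = refl

  powℤ-1* : ∀ i → powℤ q (+ 1 ℤ.* i) ≈ powℤ q i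
  powℤ-1* i rewrite ℤP.*-identityˡ i = refl

  powℤ-2* : ∀ i → powℤ q (+ 2 ℤ.* i) ≈ powℤ q i * powℤ q i
  powℤ-2* i rewrite ℤP.*-distribʳ-+ i (+ 1) (+ 1) | ℤP.*-identityˡ i = powℤ-+ q≉0 i i

  powℤ--1* : ∀ i → powℤ q (-[1+ 0 ] ℤ.* i) * powℤ q i ≈ 1#
  powℤ--1* i rewrite ℤP.-1*i≡-i i =
    trans (sym (powℤ-+ q≉0 (ℤ.- i) i)) (reflexive (≡.cong (powℤ q) (ℤP.+-inverseˡ i)))

  powℤ-negative : ∀ t → powℤ q -[1+ t ] * pow q (suc t) ≈ 1#
  powℤ-negative t = trans (*-comm _ _) (⁻¹-inverse _ (pow-≉0 q≉0 (suc t)))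

  pow-ex₋₇ : ∀ r → powℤ q (ex (ℤ.- + 7) (+ 0) r) ≈ ε r
  pow-ex₋₇ r = trans (powℤ-ex (+ 0) (+ 0) r) (trans (*-congʳ (*-congˡ (powℤ-0* (+ (r ℕ.* 3)))))
    (trans (*-identityʳ _) (*-identityʳ _)))

  pow-ex₅ : ∀ t r → powℤ q (ex (+ 5) t r) ≈ ε r * (X r * X r) * powℤ q t
  pow-ex₅ t r = trans (powℤ-ex (+ 2) t r) (*-congʳ (*-congˡ (powℤ-2* (+ (r ℕ.* 3)))))

  pow-ex₋₁ : ∀ t r → powℤ q (ex (ℤ.- + 1) t r) ≈ ε r * X r * powℤ q t
  pow-ex₋₁ t r = trans (powℤ-ex (+ 1) t r) (*-congʳ (*-congˡ (powℤ-1* (+ (r ℕ.* 3)))))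

  pow-ex₋₁₃ : ∀ r → powℤ q (ex (ℤ.- + 13) (+ 0) r) * X r ≈ ε r
  pow-ex₋₁₃ r = lincomb₂ (powℤ-ex -[1+ 0 ] (+ 0) r) (powℤ--1* (+ (r ℕ.* 3)))
    (solve (powℤ q (ex (ℤ.- + 13) (+ 0) r) ∷ powℤ q (-[1+ 0 ] ℤ.* + (r ℕ.* 3)) ∷ ε r ∷ X r ∷ []) (λ p y z x →
      p :* x :- z := x :* (p :- z :* y :* :1) :+ z :* (y :* x :- :1)))

  -- At index j this is the sequence of (iii) without its factor (1 - a q^(2j)) / (1 - a). The
  -- sequences of (i) and (ii) are weighted differences of it.
  δC δD δ : ℕ → Carrier
  δC r = sgn r * powℤ q (ex (ℤ.- + 7) (+ 0) r) * C e u v q r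
  δD r = sgn r * powℤ q (ex (ℤ.- + 1) (ℤ.- + 3) r) * D e u v q (suc r)
  δ = interleave δC δD (λ _ → 0#)

  Φ-cong : ∀ x {t t′} → t ≈ t′ → Φ x t ≈ Φ x t′
  Φ-cong x t≈ = +-cong (*-congˡ (+-congˡ (*-congˡ (*-cong t≈ t≈)))) (-‿cong (*-congˡ t≈))

  δC-value : ∀ r → δC r * uvDen ≈ sC r * (Φ u (X r) * Φ v (X r))
  δC-value r = trans (lincomb₂ (C-value r) (pow-ex₋₇ r)
    (solve (sgn r ∷ powℤ q (ex (ℤ.- + 7) (+ 0) r) ∷ C e u v q r ∷ uvDen ∷ ε r ∷ ratio e (pow q 5 / e) r
           ∷ Φ u (pow Q r) ∷ Φ v (pow Q r) ∷ []) (λ s p C D z R φ ψ →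
      s :* p :* C :* D :- s :* z :* R :* (φ :* ψ)
      := s :* p :* (C :* D :- :1 :* :1 :* R :* (φ :* ψ)) :+ s :* R :* φ :* ψ :* (p :- z))))
    (*-congˡ (*-cong (Φ-cong u (pow-Q r)) (Φ-cong v (pow-Q r))))

  δD-value : ∀ r → δD r * uvDen ≈ sD r * (Φ u (q * X r) * Φ v (q * X r))
  δD-value r = trans (lincomb₃ (D-value r) (pow-ex₋₁ (ℤ.- + 3) r) (powℤ-negative 2)
    (solve (sgn r ∷ powℤ q (ex (ℤ.- + 1) (ℤ.- + 3) r) ∷ D e u v q (suc r) ∷ uvDen ∷ ε r ∷ X r ∷ powℤ q (ℤ.- + 3) ∷ q
           ∷ ratio (e / a) (Q / e) (suc r) ∷ Φ u (q * pow Q r) ∷ Φ v (q * pow Q r) ∷ []) (λ s p C D z x i q R φ ψ →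
      s :* p :* C :* D :- s :* (q :* (z :* x)) :* R :* (φ :* ψ)
      := s :* p :* (C :* D :- q :^ 2 :* q :^ 2 :* R :* (φ :* ψ)) :+ s :* R :* φ :* ψ :* q :^ 4 :* (p :- z :* x :* i)
         :+ s :* R :* φ :* ψ :* q :* z :* x :* (i :* q :^ 3 :- :1))))
    (*-congˡ (*-cong (Φ-cong u (*-congˡ (pow-Q r))) (Φ-cong v (*-congˡ (pow-Q r)))))

  δ-value : ∀ j → δ j * uvDen ≈ s j * (Φ u (pow q j) * Φ v (pow q j))
  δ-value j with third j
  ... | 0+3* r rewrite interleave-0 δC δD (λ _ → 0#) r | interleave-0 sC sD (λ _ → 0#) r = δC-value r
  ... | 1+3* r rewrite interleave-1 δC δD (λ _ → 0#) r | interleave-1 sC sD (λ _ → 0#) r = δD-value r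
  ... | 2+3* r rewrite interleave-2 δC δD (λ _ → 0#) r | interleave-2 sC sD (λ _ → 0#) r =
    trans (zeroˡ _) (sym (zeroˡ _))

  δC₀ : δC 0 ≈ 1#
  δC₀ = trans (*-cong (*-identityʳ 1#) (/-unique (*-≉0 (Cden≉0 0) 1≉0)
    (solve [] (:1 :* :1 :* :1 :* :1 :* :1 := :1 :* (:1 :* :1 :* :1 :* :1 :* :1 :* :1))))) (*-identityʳ 1#)

  K₃-num : ∀ n → let open At n in K₃ e u v q n * K₃den e u v q n ≈
    u * v * (σ₃ - a * σ₁) * (Q * σ₃ - a * σ₁) * (a * a)
      + (1# - Q) * u * v * (a * a - σ₄) * (a * a - σ₂ * a + σ₄) * a
      + (u + v) * (a + u * v) * (σ₃ - a * σ₁) * (a * a - Q * σ₄) * a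
      + (u * u + a) * (v * v + a) * (a * a - σ₄) * (a * a - Q * σ₄)
  K₃-num n = /-*-cancel (K₃den≉0 n)

  baileySum : ℕ → Carrier
  baileySum n = sumTo (λ j → δ j * ((1# - a * (pow q j * pow q j)) * weight a n j)) n

  -- In the product of the two factors `Φ` the mixed coefficient is u (v² + a) + v (u² + a) = (u +
  -- v)(a + u v), the form in which it enters the numerator of `K`.
  baileySum-moments : ∀ n → let open At n in
    uvDen * baileySum n ≈ u * v * M m₂ + - ((u + v) * (a + u * v)) * M m₁ + (u * u + a) * (v * v + a) * M m₀
  baileySum-moments n = begin
    uvDen * baileySum n
      ≈⟨ sumTo-*ˡ uvDen _ n ⟨
    sumTo (λ j → uvDen * (δ j * ((1# - a * (pow q j * pow q j)) * weight a n j))) n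
      ≈⟨ sumTo-cong n (λ j _ → lincomb₁ (δ-value j)
           (solve (δ j ∷ s j ∷ weight a n j ∷ uvDen ∷ pow q j ∷ a ∷ u ∷ v ∷ []) (λ δ s w D t a u v →
             let y = :1 :+ a :* (t :* t)
                 k = :1 :- a :* (t :* t)
             in D :* (δ :* (k :* w))
                  :- s :* w :* (u :* v :* (k :* (y :* y)) :+ (:- ((u :+ v) :* (a :+ u :* v))) :* (k :* (t :* y))
                                :+ (u :* u :+ a) :* (v :* v :+ a) :* (k :* (t :* t)))
                := k :* w :* (δ :* D :- s :* ((u :* y :- (u :* u :+ a) :* t) :* (v :* y :- (v :* v :+ a) :* t)))))) ⟩
    M (λ x → u * v * m₂ x + - ((u + v) * (a + u * v)) * m₁ x + (u * u + a) * (v * v + a) * m₀ x)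
      ≈⟨ M-linear₃ _ _ _ m₂ m₁ m₀ ⟩
    _ ∎
    where open At n

  -- The denominator of `K₃` is made up of `uvDen`, which clears the factors in u and v, and of (a²
  -- - σ₄)(a² - p σ₄), which clears the elimination in `M-num`.
  baileySum-value : ∀ n → baileySum n ≈ (1# - a) * (K₃ e u v q n * βfac e q n)
  baileySum-value n = *-cancelˡ-≉0 (K₃den≉0 n) (begin
    K₃den e u v q n * S
      ≈⟨ solve (a ∷ Q ∷ σ₄ ∷ u ∷ v ∷ S ∷ []) (λ a p s₄ u v S →
           (a :* a :- s₄) :* (a :* a :- s₄ :* p) :* (:1 :- u) :* (a :- u) :* (:1 :- v) :* (a :- v) :* S
           := (a :* a :- s₄) :* (a :* a :- p :* s₄) :* ((:1 :- u) :* (a :- u) :* ((:1 :- v) :* (a :- v)) :* S)) ⟩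
    (a * a - σ₄) * (a * a - Q * σ₄) * (uvDen * S)
      ≈⟨ *-congˡ (baileySum-moments n) ⟩
    _ ≈⟨ M-num u v ⟩
    _ ≈⟨ *-cong (sym (K₃-num n)) (M₀-value n) ⟩
    K₃ e u v q n * K₃den e u v q n * ((1# - a) * βfac e q n)
      ≈⟨ solve (K₃ e u v q n ∷ K₃den e u v q n ∷ 1# - a ∷ βfac e q n ∷ []) (λ K D k B →
           K :* D :* (k :* B) := D :* (k :* (K :* B))) ⟩
    K₃den e u v q n * ((1# - a) * (K₃ e u v q n * βfac e q n)) ∎)
    where
    open At n
    S = baileySum n

  -- Summation by parts and the comparison of kernels.

  seq3-0 : ∀ {f₀ f₁ f₋} → f₀ 0 ≈ 1# → ∀ r → seq3 f₀ f₁ f₋ (r ℕ.* 3) ≈ f₀ r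
  seq3-0 f₀0≈1 zero = sym f₀0≈1
  seq3-0 _ (suc r) rewrite [i+r*3]%3≡i 0 (s≤s z≤n) (suc r) | [i+r*3]/3≡r 0 (s≤s z≤n) (suc r) = refl

  seq3-1 : ∀ {f₀ f₁ f₋} r → seq3 f₀ f₁ f₋ (1 ℕ.+ r ℕ.* 3) ≈ f₁ r
  seq3-1 r rewrite [i+r*3]%3≡i 1 (s≤s (s≤s z≤n)) r | [i+r*3]/3≡r 1 (s≤s (s≤s z≤n)) r = refl

  seq3-2 : ∀ {f₀ f₁ f₋} r → seq3 f₀ f₁ f₋ (2 ℕ.+ r ℕ.* 3) ≈ f₋ (suc r)
  seq3-2 r rewrite [i+r*3]%3≡i 2 (s≤s (s≤s (s≤s z≤n))) r | [i+r*3]/3≡r 2 (s≤s (s≤s (s≤s z≤n))) r = refl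

  -- Stated for f₀ with f₀ 0 = 1, so that the separate clause for index 0 is subsumed.
  seq3-differences : ∀ {f₀ f₁ f₋} (κ μ : ℕ → Carrier) → f₀ 0 ≈ 1# →
    (∀ r → f₀ r ≈ κ (r ℕ.* 3) * δC r) →
    (∀ r → f₁ r ≈ κ (1 ℕ.+ r ℕ.* 3) * δD r - μ (r ℕ.* 3) * δC r) →
    (∀ r → f₋ (suc r) ≈ - (μ (1 ℕ.+ r ℕ.* 3) * δD r)) →
    ∀ j → seq3 f₀ f₁ f₋ (suc j) ≈ κ (suc j) * δ (suc j) - μ j * δ j
  seq3-differences {f₀} {f₁} {f₋} κ μ f₀0≈1 h₀ h₁ h₂ j with third j
  ... | 0+3* r rewrite interleave-0 δC δD (λ _ → 0#) r | interleave-1 δC δD (λ _ → 0#) r =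
    trans (seq3-1 {f₀} {f₁} {f₋} r) (h₁ r)
  ... | 1+3* r rewrite interleave-1 δC δD (λ _ → 0#) r | interleave-2 δC δD (λ _ → 0#) r =
    trans (seq3-2 {f₀} {f₁} {f₋} r) (trans (h₂ r)
      (solve (κ (2 ℕ.+ r ℕ.* 3) ∷ μ (1 ℕ.+ r ℕ.* 3) * δD r ∷ []) (λ k x → :- x := k :* :0 :- x)))
  ... | 2+3* r rewrite interleave-2 δC δD (λ _ → 0#) r | interleave-0 (δC ∘ suc) (δD ∘ suc) (λ _ → 0#) r =
    trans (seq3-0 {f₀} {f₁} {f₋} f₀0≈1 (suc r)) (trans (h₀ (suc r))
      (solve (κ (3 ℕ.+ r ℕ.* 3) * δC (suc r) ∷ μ (2 ℕ.+ r ℕ.* 3) ∷ []) (λ x m → x := x :- m :* :0)))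

  -- The boundary term vanishes because the kernel is zero at n + 1. After regrouping, `weights`
  -- turns the kernel relative to q into k times the one relative to q², with k = 1 for (i) and k =
  -- qⁿ for (ii).
  bailey-by-parts : ∀ (α κ μ : ℕ → Carrier) n k → α 0 ≈ κ 0 * δ 0 →
    (∀ j → α (suc j) ≈ κ (suc j) * δ (suc j) - μ j * δ j) →
    (∀ j → (1# - a) * (κ j * weight q n j - μ j * weight q n (suc j)) ≈
           k * ((1# - a * (pow q j * pow q j)) * weight a n j)) →
    sumTo (λ j → α j * weight q n j) n ≈ k * (K₃ e u v q n * βfac e q n)
  bailey-by-parts α κ μ n k α₀ α₊ weights = *-cancelˡ-≉0 1-q²≉0 (begin
    (1# - a) * sumTo (λ j → α j * weight q n j) n
      ≈⟨ *-congˡ (sumTo-by-parts α δ κ μ (weight q n) α₀ α₊ n) ⟩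
    (1# - a) * (S + μ n * δ n * weight q n (suc n))
      ≈⟨ *-congˡ (trans (+-congˡ (trans (*-congˡ (weight-> q (ℕP.n<1+n n))) (zeroʳ _))) (+-identityʳ _)) ⟩
    (1# - a) * S
      ≈⟨ sumTo-*ˡ (1# - a) _ n ⟨
    sumTo (λ j → (1# - a) * (δ j * (κ j * weight q n j - μ j * weight q n (suc j)))) n
      ≈⟨ sumTo-cong n (λ j _ → lincomb₁ (weights j)
           (solve (1# - a ∷ δ j ∷ κ j * weight q n j - μ j * weight q n (suc j)
                  ∷ (1# - a * (pow q j * pow q j)) * weight a n j ∷ k ∷ []) (λ h δ x y k →
             h :* (δ :* x) :- k :* (δ :* y) := δ :* (h :* x :- k :* y)))) ⟩
    sumTo (λ j → k * (δ j * ((1# - a * (pow q j * pow q j)) * weight a n j))) n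
      ≈⟨ sumTo-*ˡ k _ n ⟩
    k * baileySum n
      ≈⟨ *-congˡ (baileySum-value n) ⟩
    k * ((1# - a) * (K₃ e u v q n * βfac e q n))
      ≈⟨ solve (k ∷ 1# - a ∷ K₃ e u v q n * βfac e q n ∷ []) (λ k h x → k :* (h :* x) := h :* (k :* x)) ⟩
    (1# - a) * (k * (K₃ e u v q n * βfac e q n)) ∎)
    where S = sumTo (λ j → δ j * (κ j * weight q n j - μ j * weight q n (suc j))) n

  -- A common reciprocal for `weight q n j`, `weight q n (suc j)` and `weight a n j`.
  recip : ℕ → ℕ → Carrier
  recip n j = poch (q * q) q (suc (n ℕ.+ j)) ⁻¹

  weight-q-unfold : ∀ n j → weight q n j ≈ recip-qq n j * (recip n j * (1# - a * pow q n * pow q j))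
  weight-q-unfold n j = *-congˡ (trans (recip-poch-step (q * q) q²q≉0 (n ℕ.+ j))
    (lincomb₁ (pow-+ q n j)
      (solve (recip n j ∷ q ∷ pow q n ∷ pow q j ∷ pow q (n ℕ.+ j) ∷ []) (λ i q x t y →
        i :* (:1 :- q :* q :* y) :- i :* (:1 :- q :^ 2 :* x :* t) := (:- (i :* q :^ 2)) :* (y :- x :* t)))))

  weight-q-suc : ∀ n j → weight q n (suc j) ≈ recip-qq n (suc j) * recip n j
  weight-q-suc n j = *-congˡ (reflexive (≡.cong (λ m → poch (q * q) q m ⁻¹) (ℕP.+-suc n j)))

  -- Splitting off the first factor gives (q²;q)_{n+j+1} = (1 - q²)(q³;q)_{n+j}.
  weight-a-q : ∀ n j → weight a n j ≈ recip-qq n j * (recip n j * (1# - a))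
  weight-a-q n j = *-congˡ (⁻¹-unique (q³q≉0 (n ℕ.+ j)) (begin
    poch (a * q) q (n ℕ.+ j) * (recip n j * (1# - a))
      ≈⟨ *-congʳ (poch-cong q (solve (q ∷ []) (λ q → q :^ 2 :* q := q :* (q :* q))) (n ℕ.+ j)) ⟩
    poch (q * (q * q)) q (n ℕ.+ j) * (recip n j * (1# - a))
      ≈⟨ solve (poch (q * (q * q)) q (n ℕ.+ j) ∷ recip n j ∷ q ∷ []) (λ P i q →
           P :* (i :* (:1 :- q :^ 2)) := P :* (:1 :- q :* q) :* i) ⟩
    poch (q * (q * q)) q (n ℕ.+ j) * (1# - q * q) * recip n j
      ≈⟨ *-congʳ (poch-shift (q * q) q (n ℕ.+ j)) ⟩
    poch (q * q) q (suc (n ℕ.+ j)) * recip n j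
      ≈⟨ ⁻¹-inverse _ (q²q≉0 (suc (n ℕ.+ j))) ⟩
    1# ∎))

  -- With x = qⁿ and t = q^j, `recip-qq-step` reduces the bracket to 1 - a x t - a t (t - x), in
  -- which the terms in x cancel.
  weights-i : ∀ n j → (1# - a) * (1# * weight q n j - a * (pow q j * pow q j) * weight q n (suc j)) ≈
                      1# * ((1# - a * (pow q j * pow q j)) * weight a n j)
  weights-i n j = trans
    (*-congˡ (+-cong (*-congˡ (weight-q-unfold n j)) (-‿cong (*-congˡ (weight-q-suc n j)))))
    (trans (lincomb₁ (recip-qq-step n j)
      (solve (recip-qq n j ∷ recip-qq n (suc j) ∷ recip n j ∷ a ∷ pow q n ∷ pow q j ∷ []) (λ i i′ ρ a x t →
        (:1 :- a) :* (:1 :* (i :* (ρ :* (:1 :- a :* x :* t))) :- a :* (t :* t) :* (i′ :* ρ))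
          :- :1 :* ((:1 :- a :* (t :* t)) :* (i :* (ρ :* (:1 :- a))))
        := (:1 :- a) :* ρ :* a :* t :* (i :* (t :- x) :- t :* i′))))
      (*-congˡ (*-congˡ (sym (weight-a-q n j)))))

  -- Here the bracket is t (1 - a x t) - (t - x) = x (1 - a t²), whose x = qⁿ is the extra factor in
  -- β of (ii).
  weights-ii : ∀ n j → (1# - a) * (pow q j * weight q n j - pow q j * weight q n (suc j)) ≈
                       pow q n * ((1# - a * (pow q j * pow q j)) * weight a n j)
  weights-ii n j = trans
    (*-congˡ (+-cong (*-congˡ (weight-q-unfold n j)) (-‿cong (*-congˡ (weight-q-suc n j)))))
    (trans (lincomb₁ (recip-qq-step n j)
      (solve (recip-qq n j ∷ recip-qq n (suc j) ∷ recip n j ∷ a ∷ pow q n ∷ pow q j ∷ []) (λ i i′ ρ a x t →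
        (:1 :- a) :* (t :* (i :* (ρ :* (:1 :- a :* x :* t))) :- t :* (i′ :* ρ))
          :- x :* ((:1 :- a :* (t :* t)) :* (i :* (ρ :* (:1 :- a))))
        := (:1 :- a) :* ρ :* (i :* (t :- x) :- t :* i′))))
      (*-congˡ (*-congˡ (sym (weight-a-q n j)))))

  -- The C-part of α_{3r+1} is the subtracted share of `δ (3r)`, its D-part is `δ (3r+1)` itself,
  -- and α_{3r+2} is the subtracted share of the latter, as δ vanishes at residue 2.
  α-i-suc : ∀ j → α-i e u v q (suc j) ≈ 1# * δ (suc j) - a * (pow q j * pow q j) * δ j
  α-i-suc = seq3-differences (λ _ → 1#) (λ j → a * (pow q j * pow q j)) δC₀
    (λ r → sym (*-identityˡ _))
    (λ r → lincomb₂ (pow-ex₅ (+ 2) r) (pow-ex₋₇ r)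
      (solve (sgn r ∷ powℤ q (ex (+ 5) (+ 2) r) ∷ powℤ q (ex (ℤ.- + 7) (+ 0) r) ∷ ε r ∷ X r ∷ q ∷ C e u v q r ∷ δD r ∷ [])
        (λ s p p′ z x q C D →
          (:- :1) :* s :* p :* C :+ D :- (:1 :* D :- q :^ 2 :* (x :* x) :* (s :* p′ :* C))
          := (:- (s :* C)) :* (p :- z :* (x :* x) :* q :^ 2) :+ q :^ 2 :* x :* x :* s :* C :* (p′ :- z))))
    (λ r → lincomb₃ (trans (pow-ex₋₇ (suc r)) (pow-exponent₃ r)) (pow-ex₋₁ (ℤ.- + 3) r) (powℤ-negative 2)
      (solve (sgn r ∷ powℤ q (ex (ℤ.- + 7) (+ 0) (suc r)) ∷ powℤ q (ex (ℤ.- + 1) (ℤ.- + 3) r) ∷ powℤ q (ℤ.- + 3)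
             ∷ ε r ∷ X r ∷ q ∷ D e u v q (suc r) ∷ [])
        (λ s p p′ i z x q D →
          (:- :1) :* s :* p :* D :- :- (q :^ 2 :* (q :* x :* (q :* x)) :* (s :* p′ :* D))
          := (:- (s :* D)) :* (p :- q :* (z :* x :^ 3)) :+ q :^ 4 :* x :* x :* s :* D :* (p′ :- z :* x :* i)
             :+ q :* x :^ 3 :* s :* D :* z :* (i :* q :^ 3 :- :1))))

  α-ii-suc : ∀ j → α-ii e u v q (suc j) ≈ pow q (suc j) * δ (suc j) - pow q j * δ j
  α-ii-suc = seq3-differences (pow q) (pow q) (trans (f₀≈ 0) (trans (*-identityˡ _) δC₀)) f₀≈
    (λ r → trans (+-cong (f₁C≈ r) (f₁D≈ r)) (+-comm _ _))
    -- The exponent with linear coefficient -13 is `exponent₃` minus 3(r + 1), so both sides are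
    -- first multiplied by q^(3(r+1)).
    (λ r → *-cancelʳ-≉0 (pow-≉0 q≉0 (suc r ℕ.* 3))
      (lincomb₃ (trans (pow-ex₋₁₃ (suc r)) (pow-exponent₃ r)) (pow-ex₋₁ (ℤ.- + 3) r) (powℤ-negative 2)
      (solve (sgn r ∷ powℤ q (ex (ℤ.- + 13) (+ 0) (suc r)) ∷ powℤ q (ex (ℤ.- + 1) (ℤ.- + 3) r) ∷ powℤ q (ℤ.- + 3)
             ∷ ε r ∷ X r ∷ q ∷ D e u v q (suc r) ∷ [])
        (λ s p p′ i z x q D → let x′ = q :* (q :* (q :* x)) in
          (:- :1) :* s :* p :* D :* x′ :- (:- (q :* x :* (s :* p′ :* D))) :* x′
          := (:- (s :* D)) :* (p :* x′ :- q :* (z :* x :^ 3)) :+ q :* x :* s :* D :* x′ :* (p′ :- z :* x :* i)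
             :+ q :* x :^ 3 :* s :* D :* z :* (i :* q :^ 3 :- :1)))))
    where
    f₀≈ : ∀ r → sgn r * powℤ q (ex (ℤ.- + 1) (+ 0) r) * C e u v q r ≈ X r * δC r
    f₀≈ r = lincomb₂ (pow-ex₋₁ (+ 0) r) (pow-ex₋₇ r)
      (solve (sgn r ∷ powℤ q (ex (ℤ.- + 1) (+ 0) r) ∷ powℤ q (ex (ℤ.- + 7) (+ 0) r) ∷ ε r ∷ X r ∷ C e u v q r ∷ [])
        (λ s p p′ z x C → s :* p :* C :- x :* (s :* p′ :* C)
          := s :* C :* (p :- z :* x :* :1) :+ (:- (x :* s :* C)) :* (p′ :- z)))

    f₁C≈ : ∀ r → sgn (suc r) * powℤ q (ex (ℤ.- + 1) (+ 0) r) * C e u v q r ≈ - (X r * δC r)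
    f₁C≈ r = lincomb₁ (f₀≈ r)
      (solve (sgn r ∷ powℤ q (ex (ℤ.- + 1) (+ 0) r) ∷ C e u v q r ∷ X r * δC r ∷ [])
        (λ s p C y → (:- :1) :* s :* p :* C :- :- y := (:- :1) :* (s :* p :* C :- y)))

    f₁D≈ : ∀ r → sgn r * powℤ q (ex (+ 5) (ℤ.- + 2) r) * D e u v q (suc r) ≈ q * X r * δD r
    -- Multiplication by q³ clears the constants q⁻² and q⁻³; both sides then meet in the same
    -- monomial expression.
    f₁D≈ r = *-cancelʳ-≉0 (pow-≉0 q≉0 3) (trans
      (lincomb₂ (pow-ex₅ (ℤ.- + 2) r) (powℤ-negative 1)
        (solve (sgn r ∷ powℤ q (ex (+ 5) (ℤ.- + 2) r) ∷ powℤ q (ℤ.- + 2) ∷ ε r ∷ X r ∷ q ∷ D e u v q (suc r) ∷ [])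
          (λ s p i z x q D → s :* p :* D :* q :^ 3 :- q :* x :* s :* z :* x :* D
            := s :* D :* q :^ 3 :* (p :- z :* (x :* x) :* i) :+ s :* D :* q :* z :* x :* x :* (i :* q :^ 2 :- :1))))
      (sym (lincomb₂ (pow-ex₋₁ (ℤ.- + 3) r) (powℤ-negative 2)
        (solve (sgn r ∷ powℤ q (ex (ℤ.- + 1) (ℤ.- + 3) r) ∷ powℤ q (ℤ.- + 3) ∷ ε r ∷ X r ∷ q ∷ D e u v q (suc r) ∷ [])
          (λ s p i z x q D → q :* x :* (s :* p :* D) :* q :^ 3 :- q :* x :* s :* z :* x :* D
            := q :* x :* s :* D :* q :^ 3 :* (p :- z :* x :* i)
               :+ q :* x :* s :* D :* z :* x :* (i :* q :^ 3 :- :1))))))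

  pow-6* : ∀ r k → pow q (6 ℕ.* r ℕ.+ k) ≈ X r * X r * pow q k
  pow-6* r k = trans (pow-+ q (6 ℕ.* r) k) (*-congʳ (trans
    (reflexive (≡.cong (pow q) (≡.trans (ℕP.*-comm 6 r) (ℕP.*-distribˡ-+ r 3 3))))
    (pow-+ q (r ℕ.* 3) (r ℕ.* 3))))

  α-iii-value : ∀ j → (1# - a) * α-iii e u v q j ≈ (1# - a * (pow q j * pow q j)) * δ j
  α-iii-value j with third j
  ... | 0+3* r rewrite interleave-0 δC δD (λ _ → 0#) r =
    trans (*-congˡ (seq3-0 (*-cancelˡ-≉0 1-q²≉0 (trans (f₀≈ 0)
      (lincomb₁ δC₀ (solve (δC 0 ∷ a ∷ []) (λ δ a → (:1 :- a :* (:1 :* :1)) :* δ :- (:1 :- a) :* :1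
        := (:1 :- a) :* (δ :- :1)))))) r)) (f₀≈ r)
    where
    f₀≈ : ∀ r → (1# - a) * (sgn r * ((1# - pow q (6 ℕ.* r ℕ.+ 2)) / (1# - a))
            * powℤ q (ex (ℤ.- + 7) (+ 0) r) * C e u v q r) ≈ (1# - a * (X r * X r)) * δC r
    f₀≈ r = lincomb₂ (/-*-cancel {1# - pow q (6 ℕ.* r ℕ.+ 2)} 1-q²≉0) (pow-6* r 2)
      (solve ((1# - pow q (6 ℕ.* r ℕ.+ 2)) / (1# - a) ∷ pow q (6 ℕ.* r ℕ.+ 2) ∷ sgn r
             ∷ powℤ q (ex (ℤ.- + 7) (+ 0) r) ∷ C e u v q r ∷ X r ∷ a ∷ []) (λ y z s p C x a →
        (:1 :- a) :* (s :* y :* p :* C) :- (:1 :- a :* (x :* x)) :* (s :* p :* C)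
        := s :* p :* C :* (y :* (:1 :- a) :- (:1 :- z)) :+ (:- (s :* p :* C)) :* (z :- x :* x :* a)))
  ... | 1+3* r rewrite interleave-1 δC δD (λ _ → 0#) r = trans (*-congˡ (seq3-1 r))
    (lincomb₂ (/-*-cancel {1# - pow q (6 ℕ.* r ℕ.+ 4)} 1-q²≉0) (pow-6* r 4)
      (solve ((1# - pow q (6 ℕ.* r ℕ.+ 4)) / (1# - a) ∷ pow q (6 ℕ.* r ℕ.+ 4) ∷ sgn r
             ∷ powℤ q (ex (ℤ.- + 1) (ℤ.- + 3) r) ∷ D e u v q (suc r) ∷ X r ∷ q ∷ []) (λ y z s p D x q →
        (:1 :- q :^ 2) :* (s :* y :* p :* D) :- (:1 :- q :^ 2 :* (q :* x :* (q :* x))) :* (s :* p :* D)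
        := s :* p :* D :* (y :* (:1 :- q :^ 2) :- (:1 :- z)) :+ (:- (s :* p :* D)) :* (z :- x :* x :* q :^ 4))))
  ... | 2+3* r rewrite interleave-2 δC δD (λ _ → 0#) r =
    trans (*-congˡ (seq3-2 r)) (trans (zeroʳ _) (sym (zeroʳ _)))

  -- Assembly of the three Bailey pairs.

  -- The index n = 0 is treated apart since β₀ is 1 by definition and not through the formula with
  -- `K₃`.
  α₀-sum : 1# ≈ 1# / (1# * 1#)
  α₀-sum = sym (/-unique (*-≉0 1≉0 1≉0) (solve [] (:1 := :1 :* (:1 :* :1))))

  baileyPair-i : BaileyPair q q (α-i e u v q) (β-i e u v q)
  baileyPair-i = refl , λ where
    zero      → α₀-sum
    n@(suc _) → sym (trans (bailey-sum q q²q≉0 _ n) (trans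
      (bailey-by-parts (α-i e u v q) (λ _ → 1#) (λ j → a * (pow q j * pow q j)) n 1#
        (sym (trans (*-identityˡ _) δC₀)) α-i-suc (weights-i n))
      (*-identityˡ _)))

  baileyPair-ii : BaileyPair q q (α-ii e u v q) (β-ii e u v q)
  baileyPair-ii = refl , λ where
    zero      → α₀-sum
    n@(suc _) → sym (trans (bailey-sum q q²q≉0 _ n) (trans
      (bailey-by-parts (α-ii e u v q) (pow q) (pow q) n (pow q n)
        (sym (trans (*-identityˡ _) δC₀)) α-ii-suc (weights-ii n))
      (*-comm _ _)))

  baileyPair-iii : BaileyPair (pow q 2) q (α-iii e u v q) (β-iii e u v q)
  baileyPair-iii = refl , λ where
    zero      → α₀-sum
    n@(suc _) → sym (trans (bailey-sum a q³q≉0 _ n) (*-cancelˡ-≉0 1-q²≉0 (begin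
      (1# - a) * sumTo (λ j → α-iii e u v q j * weight a n j) n
        ≈⟨ sumTo-*ˡ (1# - a) _ n ⟨
      sumTo (λ j → (1# - a) * (α-iii e u v q j * weight a n j)) n
        ≈⟨ sumTo-cong n (λ j _ → lincomb₁ (α-iii-value j)
             (solve (1# - a ∷ α-iii e u v q j ∷ δ j ∷ weight a n j ∷ 1# - a * (pow q j * pow q j) ∷ []) (λ h α δ w y →
               h :* (α :* w) :- δ :* (y :* w) := w :* (h :* α :- y :* δ)))) ⟩
      baileySum n
        ≈⟨ baileySum-value n ⟩
      (1# - a) * (K₃ e u v q n * βfac e q n) ∎)))

theorem2p7 : ∀ {c ℓ} (F : Field c ℓ) → FieldDefs.CharZero F →
    ∀ e u v q → FieldDefs.Generic F e u v q →
    FieldDefs.BaileyPair F q q (FieldDefs.α-i F e u v q) (FieldDefs.β-i F e u v q)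
    × FieldDefs.BaileyPair F q q (FieldDefs.α-ii F e u v q) (FieldDefs.β-ii F e u v q)
    × FieldDefs.BaileyPair F (FieldDefs.pow F q 2) q (FieldDefs.α-iii F e u v q) (FieldDefs.β-iii F e u v q)
theorem2p7 F _ e u v q gen = baileyPair-i , baileyPair-ii , baileyPair-iii
  where open CubicBaileyPairs F e u v q gen
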